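{- Let $B$ be a set of cells of an $m\times n$ array that contains exactly $h\geq 3$ cells in each row and exactly $k\geq 3$ cells in each column, and assume that $B$ admits two compatible orderings $\alpha_r$ and $\alpha_c$. Given $\Omega\subset\mathbb{Z}_{2nk+t}$ such that $[\pm x\mid x\in\Omega]$ contains each element of $\mathbb{Z}_{2nk+t}\setminus\frac{2nk+t}{t}\mathbb{Z}_{2nk+t}$ exactly once, let $\mathcal{A}$ be the set of all the $\mathrm{QH}_t(m,n;h,k)$, $A$, such that $\mathrm{skel}(A)=B$ and $\mathcal{E}(A)=\Omega$. Choose $A\in\mathcal{A}$ uniformly at random, denote by $\omega_r$ and $\omega_c$ the compatible orderings of $A$ that correspond to $\alpha_r$ and $\alpha_c$, and by $\Pi$ the Archdeacon embedding of $K_{\frac{2nk+t}{t}\times t}$ defined by $A$ (with these orderings). Then the probability that there exists $\sigma\in \mathrm{Aut}(\Pi)$ that is not a translation (i.e. that $\mathrm{Aut}(\Pi)\neq\mathbb{Z}_{2nk+t}$) is, considering $t$ fixed, $O\left(\frac{1}{nk}\right)$.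
   Context: Asymptotic convention: "$O(\cdot)$, considering $t$ fixed" means that the implied constant depends only on $t$ (not on $m,n,h,k,B,\alpha_r,\alpha_c,\Omega$). Arrays. A partially filled (p.f.) array is a matrix in which some cells may be empty. Let $v=2nk+t$ where $t$ divides $2nk$, and let $J=\frac{v}{t}\mathbb{Z}_v$ be the subgroup of $\mathbb{Z}_v$ of order $t$. A quasi-Heffter array $\mathrm{QH}_t(m,n;h,k)$ is an $m\times n$ p.f. array $A$ with entries in $\mathbb{Z}_v$ such that each row contains exactly $h$ filled cells, each column contains exactly $k$ filled cells, and the multiset $[\pm x\mid x\in A]$ contains each element of $\mathbb{Z}_v\setminus J$ exactly once. $\mathcal{E}(A)$ is the list (set) of entries of $A$; $\mathrm{skel}(A)$ is the set of filled cells of $A$. Orderings. An ordering $\alpha_r$ of the rows of $B$ is a permutation of $B$ that is the product of one cyclic permutation for each row, acting on all cells of $B$ in that row; an ordering $\alpha_c$ of the columns is defined similarly. They are compatible if $\alpha_r\circ\alpha_c$ (equivalently $\alpha_c\circ\alpha_r$) is a single cycle of length $|B|$. If $\mathrm{skel}(A)=B$ and $p(x)\in B$ is the cell of $A$ containing $x\in\mathcal{E}(A)$, the corresponding orderings of $A$ are the permutations of $\mathcal{E}(A)$ given by $\omega_r=p^{ -1}\circ\alpha_r\circ p$ and $\omega_c=p^{ -1}\circ\alpha_c\circ p$. Embeddings. A combinatorial embedding (into an orientable surface) of a connected graph $\Gamma$ is a pair $(\Gamma,\rho)$ where $\rho$ is a permutation of the oriented edges with $\rho(x,y)=(x,\rho_x(y))$,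 each $\rho_x$ being a cyclic permutation of all neighbours of $x$. $K_{\frac{v}{t}\times t}$ is the complete multipartite graph with $v/t$ parts of size $t$; its vertex set is identified with $\mathbb{Z}_v$, two vertices being adjacent iff their difference is not in $J$. The Archdeacon embedding defined by $A,\omega_r,\omega_c$ is $\Pi=(K_{\frac{v}{t}\times t},\rho)$ with $\rho(x,x+a)=(x,x+\rho_0(a))$, where $\rho_0$ is the permutation of $\pm\mathcal{E}(A)=\mathbb{Z}_v\setminus J$ given by $\rho_0(a)=-\omega_r(a)$ if $a\in\mathcal{E}(A)$ and $\rho_0(a)=\omega_c(-a)$ if $a\in-\mathcal{E}(A)$. Automorphisms. $\mathrm{Aut}(\Pi)$ is the group of graph automorphisms $\sigma$ (acting on oriented edges by $\sigma(x,y)=(\sigma(x),\sigma(y))$) such that either $\sigma\circ\rho=\rho\circ\sigma$ or $\sigma\circ\rho=\rho^{ -1}\circ\sigma$. All translations $\tau_g(x)=x+g$, $g\in\mathbb{Z}_v$, belong to $\mathrm{Aut}(\Pi)$, and $\mathrm{Aut}(\Pi)=\mathbb{Z}_v$ means that it consists exactly of the translations. -}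

module Defs where

open import Algebra.Bundles using (AbelianGroup)
open import Data.Bool using (Bool; not; T)
open import Data.Bool.Properties using (T-irrelevant)
open import Data.Fin using (Fin; zero; toℕ)
open import Data.Fin.Properties using (toℕ-injective; toℕ-fromℕ<; toℕ<n; any?; _≟_)
open import Data.Fin.Subset using (Subset; _∈_; ∣_∣)
open import Data.Fin.Subset.Properties using (nonempty?; Empty-unique; ∣⊥∣≡0)
open import Data.Integer using (+_)
open import Data.List using (List; length)
open import Data.List.Membership.Propositional using () renaming (_∈_ to _∈ˡ_)
open import Data.List.Relation.Unary.Unique.Propositional using (Unique)
open import Data.Maybe using (Maybe; just; nothing; is-just)
open import Data.Nat using (ℕ; zero; suc; _+_; _*_; _∸_; _≤_; _/_; _%_; NonZero)
open import Data.Nat.Divisibility using (_∣_)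
open import Data.Nat.DivMod using (_mod_; m<n⇒m%n≡m; %-distribˡ-+; %-distribˡ-*; m%n%n≡m%n; n%n≡0; m*n%n≡0)
open import Data.Nat.GeneralisedArithmetic using (iterate)
open import Data.Nat.Properties using (+-comm; +-assoc; *-distribˡ-+; m∸n+n≡m; <⇒≤; *-zeroʳ)
open import Data.Product using (Σ; ∃; ∃!; _×_; _,_; proj₁; proj₂)
import Data.Rational as ℚ
open import Data.Rational using (ℚ)
open import Data.Sign using (Sign)
open import Data.Sum using (_⊎_; inj₁; inj₂)
open import Data.Unit using (tt)
open import Data.Vec using (Vec; []; _∷_; map; lookup; here; there)
open import Function using (_∘_; _↔_; _⇔_; Inverse; mk↔ₛ′)
open import Function.Construct.Composition using (_↔-∘_)
open import Function.Construct.Symmetry using (↔-sym)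
open import Relation.Binary.Construct.Closure.ReflexiveTransitive using (Star; ε; _◅_)
open import Relation.Binary.PropositionalEquality
open import Relation.Nullary using (¬_; Dec; yes; no; does; contradiction)

open Inverse using (to; from; strictlyInverseˡ; strictlyInverseʳ)

module _ {v : ℕ} .{{_ : NonZero v}} where

  infixl 6 _+ᵥ_ _-ᵥ_
  infix  8 -ᵥ_

  0ᵥ : Fin v
  0ᵥ = 0 mod v

  _+ᵥ_ : Fin v → Fin v → Fin v
  x +ᵥ y = (toℕ x + toℕ y) mod v

  -ᵥ_ : Fin v → Fin v
  -ᵥ x = (v ∸ toℕ x) mod v

  _-ᵥ_ : Fin v → Fin v → Fin v
  x -ᵥ y = x +ᵥ (-ᵥ y)

  toℕ-mod : ∀ a → toℕ (a mod v) ≡ a % v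
  toℕ-mod a = toℕ-fromℕ< _

  mod-cong : ∀ {a b} → a % v ≡ b % v → a mod v ≡ b mod v
  mod-cong {a} {b} eq = toℕ-injective (trans (toℕ-mod a) (trans eq (sym (toℕ-mod b))))

  mod-toℕ : ∀ x → toℕ x mod v ≡ x
  mod-toℕ x = toℕ-injective (trans (toℕ-mod (toℕ x)) (m<n⇒m%n≡m (toℕ<n x)))

  mod-+ : ∀ a b → (a mod v) +ᵥ (b mod v) ≡ (a + b) mod v
  mod-+ a b = mod-cong (trans (cong₂ (λ p q → (p + q) % v) (toℕ-mod a) (toℕ-mod b))
                              (sym (%-distribˡ-+ a b v)))

  +ᵥ-comm : ∀ x y → x +ᵥ y ≡ y +ᵥ x
  +ᵥ-comm x y = cong (_mod v) (+-comm (toℕ x) (toℕ y))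

  +ᵥ-assoc : ∀ x y z → (x +ᵥ y) +ᵥ z ≡ x +ᵥ (y +ᵥ z)
  +ᵥ-assoc x y z = begin
    (x +ᵥ y) +ᵥ z                   ≡⟨ cong ((x +ᵥ y) +ᵥ_) (mod-toℕ z) ⟨
    (x +ᵥ y) +ᵥ (toℕ z mod v)       ≡⟨ mod-+ (toℕ x + toℕ y) (toℕ z) ⟩
    (toℕ x + toℕ y + toℕ z) mod v   ≡⟨ cong (_mod v) (+-assoc (toℕ x) (toℕ y) (toℕ z)) ⟩
    (toℕ x + (toℕ y + toℕ z)) mod v ≡⟨ mod-+ (toℕ x) (toℕ y + toℕ z) ⟨
    (toℕ x mod v) +ᵥ (y +ᵥ z)       ≡⟨ cong (_+ᵥ (y +ᵥ z)) (mod-toℕ x) ⟩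
    x +ᵥ (y +ᵥ z)                   ∎
    where open ≡-Reasoning

  +ᵥ-identityˡ : ∀ x → 0ᵥ +ᵥ x ≡ x
  +ᵥ-identityˡ x = begin
    0ᵥ +ᵥ x              ≡⟨ cong (0ᵥ +ᵥ_) (mod-toℕ x) ⟨
    0ᵥ +ᵥ (toℕ x mod v)  ≡⟨ mod-+ 0 (toℕ x) ⟩
    toℕ x mod v          ≡⟨ mod-toℕ x ⟩
    x                    ∎
    where open ≡-Reasoning

  +ᵥ-inverseˡ : ∀ x → (-ᵥ x) +ᵥ x ≡ 0ᵥ
  +ᵥ-inverseˡ x = begin
    (-ᵥ x) +ᵥ x                ≡⟨ cong ((-ᵥ x) +ᵥ_) (mod-toℕ x) ⟨
    (-ᵥ x) +ᵥ (toℕ x mod v)    ≡⟨ mod-+ (v ∸ toℕ x) (toℕ x) ⟩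
    (v ∸ toℕ x + toℕ x) mod v  ≡⟨ mod-cong (trans (cong (_% v) (m∸n+n≡m (<⇒≤ (toℕ<n x))))
                                                  (trans (n%n≡0 v) (sym (m*n%n≡0 0 v)))) ⟩
    0ᵥ                         ∎
    where open ≡-Reasoning

  ℤᵥ : AbelianGroup _ _
  ℤᵥ = record
    { Carrier = Fin v ; _≈_ = _≡_ ; _∙_ = _+ᵥ_ ; ε = 0ᵥ ; _⁻¹ = -ᵥ_
    ; isAbelianGroup = record
      { isGroup = record
        { isMonoid = record
          { isSemigroup = record
            { isMagma = record { isEquivalence = isEquivalence ; ∙-cong = cong₂ _+ᵥ_ }
            ; assoc = +ᵥ-assoc }
          ; identity = +ᵥ-identityˡ , λ x → trans (+ᵥ-comm x 0ᵥ) (+ᵥ-identityˡ x) }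
        ; inverse = +ᵥ-inverseˡ , λ x → trans (+ᵥ-comm x (-ᵥ x)) (+ᵥ-inverseˡ x)
        ; ⁻¹-cong = cong (-ᵥ_) }
      ; comm = +ᵥ-comm } }

  open import Algebra.Properties.AbelianGroup ℤᵥ public
    using () renaming (⁻¹-involutive to -ᵥ-involutive; ⁻¹-∙-comm to -ᵥ-+ᵥ-comm)

  x+[y-x]≡y : ∀ x y → x +ᵥ (y -ᵥ x) ≡ y
  x+[y-x]≡y x y = begin
    x +ᵥ (y -ᵥ x)      ≡⟨ +ᵥ-comm x (y -ᵥ x) ⟩
    (y +ᵥ -ᵥ x) +ᵥ x   ≡⟨ +ᵥ-assoc y (-ᵥ x) x ⟩
    y +ᵥ (-ᵥ x +ᵥ x)   ≡⟨ cong (y +ᵥ_) (+ᵥ-inverseˡ x) ⟩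
    y +ᵥ 0ᵥ            ≡⟨ +ᵥ-comm y 0ᵥ ⟩
    0ᵥ +ᵥ y            ≡⟨ +ᵥ-identityˡ y ⟩
    y                  ∎
    where open ≡-Reasoning

  [x+y]-x≡y : ∀ x y → (x +ᵥ y) -ᵥ x ≡ y
  [x+y]-x≡y x y = begin
    (x +ᵥ y) -ᵥ x  ≡⟨ +ᵥ-assoc x y (-ᵥ x) ⟩
    x +ᵥ (y -ᵥ x)  ≡⟨ x+[y-x]≡y x y ⟩
    y              ∎
    where open ≡-Reasoning

  neg-sub : ∀ x y → -ᵥ (y -ᵥ x) ≡ x -ᵥ y
  neg-sub x y = begin
    -ᵥ (y +ᵥ -ᵥ x)       ≡⟨ -ᵥ-+ᵥ-comm y (-ᵥ x) ⟨
    -ᵥ y +ᵥ -ᵥ (-ᵥ x)    ≡⟨ cong (-ᵥ y +ᵥ_) (-ᵥ-involutive x) ⟩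
    -ᵥ y +ᵥ x            ≡⟨ +ᵥ-comm (-ᵥ y) x ⟩
    x -ᵥ y               ∎
    where open ≡-Reasoning

  -- J = (v/t) ℤ_v
  InJ : (t : ℕ) .{{_ : NonZero t}} → Fin v → Set
  InJ t x = ∃ λ (y : Fin v) → x ≡ (v / t * toℕ y) mod v

  module _ (t : ℕ) .{{_ : NonZero t}} where

    inJ? : ∀ x → Dec (InJ t x)
    inJ? x = any? (λ y → x ≟ (v / t * toℕ y) mod v)

    J-multiple : ∀ a → InJ t ((v / t * a) mod v)
    J-multiple a = a mod v , mod-cong (begin
      (v / t * a) % v                  ≡⟨ %-distribˡ-* (v / t) a v ⟩
      (v / t % v * (a % v)) % v        ≡⟨ cong (λ b → (v / t % v * b) % v) (m%n%n≡m%n a v) ⟨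
      (v / t % v * (a % v % v)) % v    ≡⟨ %-distribˡ-* (v / t) (a % v) v ⟨
      (v / t * (a % v)) % v            ≡⟨ cong (λ b → (v / t * b) % v) (toℕ-mod a) ⟨
      (v / t * toℕ (a mod v)) % v      ∎)
      where open ≡-Reasoning

    J-0 : InJ t 0ᵥ
    J-0 = subst (InJ t) (cong (_mod v) (*-zeroʳ (v / t))) (J-multiple 0)

    J-+ : ∀ {x y} → InJ t x → InJ t y → InJ t (x +ᵥ y)
    J-+ (a , refl) (b , refl) = subst (InJ t)
      (sym (trans (mod-+ (v / t * toℕ a) (v / t * toℕ b))
                  (cong (_mod v) (sym (*-distribˡ-+ (v / t) (toℕ a) (toℕ b))))))
      (J-multiple (toℕ a + toℕ b))

    J-neg : ∀ {x} → InJ t x → InJ t (-ᵥ x)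
    J-neg (a , refl) = -ᵥ a , sym (inverseˡ-unique _ _ (begin
      ((v / t * toℕ (-ᵥ a)) mod v) +ᵥ ((v / t * toℕ a) mod v)
        ≡⟨ mod-+ (v / t * toℕ (-ᵥ a)) (v / t * toℕ a) ⟩
      (v / t * toℕ (-ᵥ a) + v / t * toℕ a) mod v
        ≡⟨ cong (_mod v) (*-distribˡ-+ (v / t) (toℕ (-ᵥ a)) (toℕ a)) ⟨
      (v / t * (toℕ (-ᵥ a) + toℕ a)) mod v
        ≡⟨ proj₂ (J-multiple (toℕ (-ᵥ a) + toℕ a)) ⟩
      (v / t * toℕ (-ᵥ a +ᵥ a)) mod v
        ≡⟨ cong (λ z → (v / t * toℕ z) mod v) (+ᵥ-inverseˡ a) ⟩
      (v / t * toℕ 0ᵥ) mod v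
        ≡⟨ cong (λ z → (v / t * z) mod v) (trans (toℕ-mod 0) (m*n%n≡0 0 v)) ⟩
      (v / t * 0) mod v
        ≡⟨ cong (_mod v) (*-zeroʳ (v / t)) ⟩
      0ᵥ ∎))
      where
      open ≡-Reasoning
      open import Algebra.Properties.AbelianGroup ℤᵥ using (inverseˡ-unique)

  signed : Sign → Fin v → Fin v
  signed Sign.+ x = x
  signed Sign.- x = -ᵥ x

  -- For a family x : I → ℤ_v, the multiset [ ± x i | i ∈ I ] (the family of
  -- the signed s (x i), indexed by Sign × I) contains each element of
  -- ℤ_v ∖ J exactly once, and nothing else.
  ±CoversOnce : (t : ℕ) .{{_ : NonZero t}} {I : Set} → (I → Fin v) → Set
  ±CoversOnce t {I} x =
      (∀ z → ¬ InJ t z → ∃! _≡_ λ ((s , i) : Sign × I) → signed s (x i) ≡ z)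
    × (∀ s i → ¬ InJ t (signed s (x i)))

Cells : ℕ → ℕ → Set
Cells m n = Vec (Subset n) m

record Cell {m n : ℕ} (B : Cells m n) : Set where
  constructor cell
  field
    row    : Fin m
    col    : Fin n
    filled : col ∈ lookup B row

column : {m n : ℕ} → Cells m n → Fin n → Subset m
column B j = map (λ r → lookup r j) B

PFArray : (v m n : ℕ) → Set
PFArray v m n = Vec (Vec (Maybe (Fin v)) n) m

module _ {v : ℕ} where

  skel : ∀ {m n} → PFArray v m n → Cells m n
  skel = map (map is-just)

  rowEntry : ∀ {n} (r : Vec (Maybe (Fin v)) n) {j} → j ∈ map is-just r → Fin v
  rowEntry (just x ∷ _) here      = x
  rowEntry (_      ∷ r) (there p) = rowEntry r p

  entry : ∀ {m n} (A : PFArray v m n) → Cell (skel A) → Fin v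
  entry (r ∷ _) (cell zero        _ p) = rowEntry r p
  entry (_ ∷ A) (cell (Fin.suc i) j p) = entry A (cell i j p)

  _∈ℰ_ : ∀ {m n} → Fin v → PFArray v m n → Set
  x ∈ℰ A = ∃ λ c → entry A c ≡ x

record IsQuasiHeffter {v m n : ℕ} .{{_ : NonZero v}} (t h k : ℕ) .{{_ : NonZero t}}
                      (A : PFArray v m n) : Set where
  field
    order   : v ≡ 2 * n * k + t
    divides : t ∣ 2 * n * k
    rows    : ∀ i → ∣ lookup (skel A) i ∣ ≡ h
    columns : ∀ j → ∣ column (skel A) j ∣ ≡ k
    covers  : ±CoversOnce t (entry A)

-- On each fibre of f, π restricts to one cyclic permutation of the whole fibre.
CyclicOnFibres : {X Y : Set} → (X → Y) → X ↔ X → Set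
CyclicOnFibres f π =
    (∀ x → f (to π x) ≡ f x)
  × (∀ x y → f x ≡ f y → ∃ λ i → iterate (to π) x i ≡ y)

SingleCycle : {X : Set} → X ↔ X → Set
SingleCycle π = ∀ x y → ∃ λ i → iterate (to π) x i ≡ y

module _ {m n : ℕ} {B : Cells m n} where

  IsRowOrdering : Cell B ↔ Cell B → Set
  IsRowOrdering = CyclicOnFibres Cell.row

  IsColumnOrdering : Cell B ↔ Cell B → Set
  IsColumnOrdering = CyclicOnFibres Cell.col

  Compatible : (αr αc : Cell B ↔ Cell B) → Set
  Compatible αr αc = SingleCycle (αr ↔-∘ αc)

record Graph (V : Set) : Set where
  field
    adj         : V → V → Bool
    symmetric   : ∀ {x y} → T (adj x y) → T (adj y x)
    irreflexive : ∀ {x} → ¬ T (adj x x)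

  OrientedEdge : Set
  OrientedEdge = Σ V λ x → Σ V λ y → T (adj x y)

  source : OrientedEdge → V
  source (x , _ , _) = x

  IsConnected : Set
  IsConnected = ∀ x y → Star (λ a b → T (adj a b)) x y

record CombinatorialEmbedding {V : Set} (Γ : Graph V) : Set where
  open Graph Γ
  field
    connected : IsConnected
    ρ         : OrientedEdge ↔ OrientedEdge
    rotation  : CyclicOnFibres source ρ

module _ {V : Set} {Γ : Graph V} where

  open Graph Γ

  IsGraphAutomorphism : V ↔ V → Set
  IsGraphAutomorphism σ = ∀ x y → adj (to σ x) (to σ y) ≡ adj x y

  onEdges : (σ : V ↔ V) → IsGraphAutomorphism σ → OrientedEdge → OrientedEdge
  onEdges σ aut (x , y , e) = to σ x , to σ y , subst T (sym (aut x y)) e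

  IsAutomorphism : CombinatorialEmbedding Γ → V ↔ V → Set
  IsAutomorphism Π σ = Σ (IsGraphAutomorphism σ) λ aut →
      (∀ e → onEdges σ aut (to ρ e) ≡ to   ρ (onEdges σ aut e))
    ⊎ (∀ e → onEdges σ aut (to ρ e) ≡ from ρ (onEdges σ aut e))
    where open CombinatorialEmbedding Π

IsTranslation : {v : ℕ} .{{_ : NonZero v}} → Fin v ↔ Fin v → Set
IsTranslation σ = ∃ λ g → ∀ x → to σ x ≡ x +ᵥ g

module _ (v t : ℕ) .{{_ : NonZero v}} .{{_ : NonZero t}} where

  adjK : Fin v → Fin v → Bool
  adjK x y = not (does (inJ? t (y -ᵥ x)))

module _ {v t : ℕ} .{{_ : NonZero v}} .{{_ : NonZero t}} where

  adjK⇒∉J : (x y : Fin v) → T (adjK v t x y) → ¬ InJ t (y -ᵥ x)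
  adjK⇒∉J x y e with inJ? t (y -ᵥ x)
  ... | no ∉J = ∉J

  ∉J⇒adjK : (x y : Fin v) → ¬ InJ t (y -ᵥ x) → T (adjK v t x y)
  ∉J⇒adjK x y ∉J with inJ? t (y -ᵥ x)
  ... | yes ∈J = ∉J ∈J
  ... | no _   = tt

K : (v t : ℕ) .{{_ : NonZero v}} .{{_ : NonZero t}} → Graph (Fin v)
K v t = record
  { adj         = adjK v t
  ; symmetric   = λ {x} {y} e → ∉J⇒adjK y x λ ∈J →
      adjK⇒∉J x y e (subst (InJ t) (neg-sub y x) (J-neg t ∈J))
  ; irreflexive = λ {x} e → adjK⇒∉J x x e
      (subst (InJ t) (trans (sym (+ᵥ-inverseˡ x)) (+ᵥ-comm (-ᵥ x) x)) (J-0 t))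
  }

K-connected : {v t : ℕ} .{{_ : NonZero v}} .{{_ : NonZero t}} →
              (z : Fin v) → ¬ InJ t z → Graph.IsConnected (K v t)
K-connected {v} {t} z z∉J x y with inJ? t (y -ᵥ x)
... | no  ∉J = ∉J⇒adjK x y ∉J ◅ ε
... | yes ∈J = ∉J⇒adjK x (x +ᵥ z) (z∉J ∘ subst (InJ t) ([x+y]-x≡y x z))
             ◅ ∉J⇒adjK (x +ᵥ z) y (λ ∈J′ → z∉J (subst (InJ t) eq (J-+ t ∈J (J-neg t ∈J′))))
             ◅ ε
  where
  open ≡-Reasoning
  eq : (y -ᵥ x) +ᵥ -ᵥ (y -ᵥ (x +ᵥ z)) ≡ z
  eq = begin
    (y -ᵥ x) +ᵥ -ᵥ (y -ᵥ (x +ᵥ z))  ≡⟨ cong ((y -ᵥ x) +ᵥ_) (neg-sub (x +ᵥ z) y) ⟩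
    (y -ᵥ x) +ᵥ ((x +ᵥ z) -ᵥ y)     ≡⟨ +ᵥ-assoc (y -ᵥ x) (x +ᵥ z) (-ᵥ y) ⟨
    ((y -ᵥ x) +ᵥ (x +ᵥ z)) -ᵥ y     ≡⟨ cong (_-ᵥ y) (+ᵥ-assoc (y -ᵥ x) x z) ⟨
    (((y -ᵥ x) +ᵥ x) +ᵥ z) -ᵥ y     ≡⟨ cong (λ w → (w +ᵥ z) -ᵥ y)
                                         (trans (+ᵥ-comm (y -ᵥ x) x) (x+[y-x]≡y x y)) ⟩
    (y +ᵥ z) -ᵥ y                   ≡⟨ [x+y]-x≡y y z ⟩
    z                               ∎

module Archdeacon
  {v m n t h k : ℕ} .{{_ : NonZero v}} .{{_ : NonZero t}} (A : PFArray v m n)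
  (qh : IsQuasiHeffter t h k A) (c₀ : Cell (skel A))
  (αr αc : Cell (skel A) ↔ Cell (skel A)) (compatible : Compatible αr αc)
  where

  open IsQuasiHeffter qh

  ℰ : Set
  ℰ = ∃ λ x → x ∈ℰ A

  -- The cell containing a given entry.
  p : ℰ ↔ Cell (skel A)
  p = mk↔ₛ′ (λ (_ , c , _) → c) (λ c → entry A c , c , refl) (λ _ → refl) (λ { (_ , _ , refl) → refl })

  ωr ωc : ℰ ↔ ℰ
  ωr = ↔-sym p ↔-∘ (αr ↔-∘ p)
  ωc = ↔-sym p ↔-∘ (αc ↔-∘ p)

  ℰ∪-ℰ : (a : Fin v) → ¬ InJ t a → a ∈ℰ A ⊎ (-ᵥ a) ∈ℰ A
  ℰ∪-ℰ a a∉J with proj₁ covers a a∉J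
  ... | (Sign.+ , c) , eq , _ = inj₁ (c , eq)
  ... | (Sign.- , c) , eq , _ = inj₂ (c , trans (sym (-ᵥ-involutive (entry A c))) (cong (-ᵥ_) eq))

  ρ₀ : (a : Fin v) → ¬ InJ t a → Fin v
  ρ₀ a a∉J with ℰ∪-ℰ a a∉J
  ... | inj₁ a∈ℰ  = -ᵥ proj₁ (to ωr (a , a∈ℰ))
  ... | inj₂ -a∈ℰ = proj₁ (to ωc (-ᵥ a , -a∈ℰ))

  ρ₀∉J : (a : Fin v) (a∉J : ¬ InJ t a) → ¬ InJ t (ρ₀ a a∉J)
  ρ₀∉J a a∉J with ℰ∪-ℰ a a∉J
  ... | inj₁ (c , _) = proj₂ covers Sign.- (to αr c)
  ... | inj₂ (c , _) = proj₂ covers Sign.+ (to αc c)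

  open Graph (K v t)

  ρ : OrientedEdge → OrientedEdge
  ρ (x , y , e) = x , x +ᵥ b , ∉J⇒adjK x (x +ᵥ b) (ρ₀∉J a a∉J ∘ subst (InJ t) ([x+y]-x≡y x b))
    where
    a   = y -ᵥ x
    a∉J = adjK⇒∉J x y e
    b   = ρ₀ a a∉J

  -- To see that ρ is a permutation, cyclic at each vertex, code the oriented
  -- edge (x , x ± entry c) by (± , c).

  Code : Set
  Code = Sign × Cell (skel A)

  value : Code → Fin v
  value (s , c) = signed s (entry A c)

  step step⁻¹ : Code → Code
  step   (Sign.+ , c) = Sign.- , to αr c
  step   (Sign.- , c) = Sign.+ , to αc c
  step⁻¹ (Sign.+ , c) = Sign.- , from αc c
  step⁻¹ (Sign.- , c) = Sign.+ , from αr c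

  step∘step⁻¹ : ∀ w → step (step⁻¹ w) ≡ w
  step∘step⁻¹ (Sign.+ , c) = cong (Sign.+ ,_) (strictlyInverseˡ αc c)
  step∘step⁻¹ (Sign.- , c) = cong (Sign.- ,_) (strictlyInverseˡ αr c)

  step⁻¹∘step : ∀ w → step⁻¹ (step w) ≡ w
  step⁻¹∘step (Sign.+ , c) = cong (Sign.+ ,_) (strictlyInverseʳ αr c)
  step⁻¹∘step (Sign.- , c) = cong (Sign.- ,_) (strictlyInverseʳ αc c)

  code : (a : Fin v) → ¬ InJ t a → Code
  code a a∉J = proj₁ (proj₁ covers a a∉J)

  value-code : (a : Fin v) (a∉J : ¬ InJ t a) → value (code a a∉J) ≡ a
  value-code a a∉J = proj₁ (proj₂ (proj₁ covers a a∉J))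

  code-unique : {a : Fin v} (a∉J : ¬ InJ t a) {w : Code} → value w ≡ a → code a a∉J ≡ w
  code-unique {a} a∉J = proj₂ (proj₂ (proj₁ covers a a∉J))

  ρ₀-code : (a : Fin v) (a∉J : ¬ InJ t a) → ρ₀ a a∉J ≡ value (step (code a a∉J))
  ρ₀-code a a∉J with proj₁ covers a a∉J
  ... | (Sign.+ , c) , eq , _ = refl
  ... | (Sign.- , c) , eq , _ = refl

  edge : Fin v → Code → OrientedEdge
  edge x w@(s , c) = x , x +ᵥ value w , ∉J⇒adjK x (x +ᵥ value w) (proj₂ covers s c ∘ subst (InJ t) ([x+y]-x≡y x (value w)))

  edge-≡ : ∀ {x y y′ e e′} → y ≡ y′ → _≡_ {A = OrientedEdge} (x , y , e) (x , y′ , e′)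
  edge-≡ {x} {y} refl = cong (λ e → x , y , e) (T-irrelevant _ _)

  edgeCode : OrientedEdge → Code
  edgeCode (x , y , e) = code (y -ᵥ x) (adjK⇒∉J x y e)

  edge-edgeCode : ∀ e → edge (source e) (edgeCode e) ≡ e
  edge-edgeCode (x , y , e) = edge-≡ (trans (cong (x +ᵥ_) (value-code (y -ᵥ x) _)) (x+[y-x]≡y x y))

  edgeCode-edge : ∀ x w → edgeCode (edge x w) ≡ w
  edgeCode-edge x w = code-unique _ (sym ([x+y]-x≡y x (value w)))

  ρ-≡ : ∀ e → ρ e ≡ edge (source e) (step (edgeCode e))
  ρ-≡ (x , y , e) = edge-≡ (cong (x +ᵥ_) (ρ₀-code (y -ᵥ x) _))

  ρ-edge : ∀ x w → ρ (edge x w) ≡ edge x (step w)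
  ρ-edge x w = trans (ρ-≡ (edge x w)) (cong (edge x ∘ step) (edgeCode-edge x w))

  ρ⁻¹ : OrientedEdge → OrientedEdge
  ρ⁻¹ e = edge (source e) (step⁻¹ (edgeCode e))

  ρ-permutation : OrientedEdge ↔ OrientedEdge
  ρ-permutation = mk↔ₛ′ ρ ρ⁻¹ invˡ invʳ
    where
    invˡ : ∀ e → ρ (ρ⁻¹ e) ≡ e
    invˡ e = trans (ρ-edge (source e) (step⁻¹ (edgeCode e)))
      (trans (cong (edge (source e)) (step∘step⁻¹ (edgeCode e))) (edge-edgeCode e))
    invʳ : ∀ e → ρ⁻¹ (ρ e) ≡ e
    invʳ e = trans (cong ρ⁻¹ (ρ-≡ e))
      (trans (cong (edge (source e) ∘ step⁻¹) (edgeCode-edge (source e) (step (edgeCode e))))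
      (trans (cong (edge (source e)) (step⁻¹∘step (edgeCode e))) (edge-edgeCode e)))

  iterate-ρ : ∀ x w i → iterate ρ (edge x w) i ≡ edge x (iterate step w i)
  iterate-ρ x w zero    = refl
  iterate-ρ x w (suc i) = trans (cong (λ e → iterate ρ e i) (ρ-edge x w)) (iterate-ρ x (step w) i)

  infix 4 _⟶*_
  _⟶*_ : Code → Code → Set
  w ⟶* w′ = ∃ λ i → iterate step w i ≡ w′

  ⟶*-trans : ∀ {w w′ w″} → w ⟶* w′ → w′ ⟶* w″ → w ⟶* w″
  ⟶*-trans (zero  , refl) q = q
  ⟶*-trans (suc i , eq)   q with ⟶*-trans (i , eq) q
  ... | j , eq′ = suc j , eq′

  -⟶*- : ∀ c d → (Sign.- , c) ⟶* (Sign.- , d)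
  -⟶*- c d with compatible c d
  ... | i , eq = go i c eq
    where
    go : ∀ i c → iterate (to (αr ↔-∘ αc)) c i ≡ d → (Sign.- , c) ⟶* (Sign.- , d)
    go zero    c refl = 0 , refl
    go (suc i) c eq   = ⟶*-trans (2 , refl) (go i (to αr (to αc c)) eq)

  -⟶* : ∀ c w → (Sign.- , c) ⟶* w
  -⟶* c (Sign.- , d) = -⟶*- c d
  -⟶* c (Sign.+ , d) =
    ⟶*-trans (-⟶*- c (from αc d)) (1 , cong (Sign.+ ,_) (strictlyInverseˡ αc d))

  step-transitive : ∀ w w′ → w ⟶* w′
  step-transitive (Sign.- , c) w = -⟶* c w
  step-transitive (Sign.+ , c) w = ⟶*-trans (1 , refl) (-⟶* (to αr c) w)

  ρ-cyclic : ∀ e e′ → source e ≡ source e′ → ∃ λ i → iterate ρ e i ≡ e′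
  ρ-cyclic e@(x , _) e′@(_ , _) refl with step-transitive (edgeCode e) (edgeCode e′)
  ... | i , eq = i , trans (cong (λ d → iterate ρ d i) (sym (edge-edgeCode e)))
                    (trans (iterate-ρ x (edgeCode e) i)
                    (trans (cong (edge x) eq) (edge-edgeCode e′)))

  Π : CombinatorialEmbedding (K v t)
  Π = record
    { connected = K-connected (entry A c₀) (proj₂ covers Sign.+ c₀)
    ; ρ         = ρ-permutation
    ; rotation  = (λ _ → refl) , ρ-cyclic
    }

module _ {v m n : ℕ} .{{_ : NonZero v}} (t h k : ℕ) .{{_ : NonZero t}} (B : Cells m n) where

  record 𝒜 (Ω : Subset v) (A : PFArray v m n) : Set where
    field
      quasiHeffter : IsQuasiHeffter t h k A
      skeleton     : skel A ≡ B
      entries      : ∀ x → x ∈ℰ A ⇔ x ∈ Ω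

someCell : ∀ {m n h} .{{_ : NonZero m}} .{{_ : NonZero h}} (B : Cells m n) →
           (∀ i → ∣ lookup B i ∣ ≡ h) → Cell B
someCell {suc _} {n} {suc _} B rows with nonempty? (lookup B zero)
... | yes (j , j∈) = cell zero j j∈
... | no  empty with trans (sym (rows zero)) (trans (cong ∣_∣ (Empty-unique empty)) (∣⊥∣≡0 n))
...   | ()

module _ {v m n t h k : ℕ} .{{_ : NonZero v}} .{{_ : NonZero m}} .{{_ : NonZero t}} .{{_ : NonZero h}}
         {B : Cells m n} where

  archdeacon : {A : PFArray v m n} (qh : IsQuasiHeffter t h k A) → skel A ≡ B →
               (αr αc : Cell B ↔ Cell B) → Compatible αr αc → CombinatorialEmbedding (K v t)
  archdeacon {A} qh refl αr αc compatible =
    Archdeacon.Π A qh (someCell (skel A) (IsQuasiHeffter.rows qh)) αr αc compatible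

  HasNonTranslation : (αr αc : Cell B ↔ Cell B) → Compatible αr αc →
                      {Ω : Subset v} {A : PFArray v m n} → 𝒜 t h k B Ω A → Set
  HasNonTranslation αr αc compatible A∈𝒜 = ∃ λ (σ : Fin v ↔ Fin v) →
      IsAutomorphism (archdeacon quasiHeffter skeleton αr αc compatible) σ × ¬ IsTranslation σ
    where open 𝒜 A∈𝒜

record Enumeration {X : Set} (P : X → Set) : Set where
  field
    elements : List X
    unique   : Unique elements
    sound    : ∀ {x} → x ∈ˡ elements → P x
    complete : ∀ {x} → P x → x ∈ˡ elements

  size : ℕ
  size = length elements

open Enumeration using (size)

-- The probability of the event E for an element of S chosen uniformly at
-- random.  Finiteness of S and E and nonemptiness of S are part of the data.
record UniformProbability {X : Set} (S : X → Set) (E : ∀ {x} → S x → Set) : Set where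
  field
    outcomes : Enumeration S
    event    : Enumeration (λ x → Σ (S x) E)
    nonempty : NonZero (size outcomes)

  value : ℚ
  value = (+ size event ℚ./ size outcomes) {{nonempty}}

-- A symmetry σ other than a translation, normalised by σ 0 = 0, acts on the neighbours ℤ_v ∖ J of 0, that is
-- on the 2N = 2nk codes ± c, as a rotation or reflection g of the cycle of ρ₀. There are at most 4N such g, so
-- it suffices that a fixed g is realised with probability O(1/N²). If two consecutive steps a, b along a face
-- at 0 add up to the value of a code u, then σ forces the image steps a′, b′ to add up to the value of g u.
-- For given a, b, u this is a pair of linear equations between the entries in O(1) cells, so it holds with
-- probability O(1/N²); summed over u, and with the case a + b ∈ J, this gives O(1/N). Two faces that share no
-- cells with each other or with the images of each other then give O(1/N²). Each factor 1/N comes from one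
-- pivot of a triangular system of equations, by swapping the entry of the pivot cell with other entries.

module Submission where

open import Defs
open import Algebra.Properties.AbelianGroup using (∙-cancelˡ)
open import Data.Bool using (true; false)
import Data.Bool as Bool
open import Data.Fin using (Fin; zero; toℕ)
import Data.Fin as Fin
import Data.List as List
open import Data.Fin.Properties using (_≟_; toℕ<n; toℕ-injective; toℕ-cast; cast-involutive; all?; any?)
open import Data.Fin.Subset using (Subset; _∈_; ∣_∣)
open import Data.Fin.Subset.Properties using (_∈?_)
open import Data.Integer using (+_)
import Data.Integer as ℤ
import Data.Integer.Properties as ℤ
open import Data.List using (List; []; _∷_; _++_; [_]; length; map; filter; concat; concatMap; allFin;
  cartesianProduct; cartesianProductWith; deduplicate)
open import Data.List.Properties using (length-map; length-++; length-tabulate; length-filter)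
import Data.List.Membership.DecPropositional as DecMembership
open import Data.List.Membership.Propositional using () renaming (_∈_ to _∈ˡ_)
open import Data.List.Membership.Propositional.Properties using (∈-∃++; ∈-++⁺ˡ; ∈-++⁺ʳ; ∈-++⁻; ∈-map⁺; ∈-map⁻;
  ∈-concat⁺′; ∈-filter⁺; ∈-filter⁻; ∈-deduplicate⁺; ∈-deduplicate⁻; ∈-cartesianProduct⁺; ∈-cartesianProduct⁻; ∈-cartesianProductWith⁺; ∈-allFin; ∈-lookup; ∈-length)
import Data.List.Relation.Unary.All as All
open import Data.List.Relation.Unary.All using (All; []; _∷_)
import Data.List.Relation.Unary.All.Properties as All
open import Data.List.Relation.Unary.AllPairs using ([]; _∷_)
import Data.List.Relation.Unary.AllPairs as AllPairs
import Data.List.Relation.Unary.AllPairs.Properties as AllPairs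
import Data.List.Relation.Unary.Any as Any
open import Data.List.Relation.Unary.Any.Properties using (lookup-index)
open import Data.List.Relation.Unary.Any using (here; there)
open import Data.List.Relation.Unary.Unique.Propositional using (Unique)
import Data.List.Relation.Unary.Unique.Propositional.Properties as Unique
import Data.List.Relation.Unary.Unique.DecPropositional.Properties as DecUnique
open import Data.Maybe using (Maybe; just; nothing; is-just; fromMaybe)
import Data.Maybe.Properties as Maybe
open import Data.Nat using (ℕ; zero; suc; _+_; _*_; _^_; _≤_; _<_; _%_; NonZero; z≤n; s≤s)
import Data.Nat as ℕ
open import Data.Nat.Divisibility using (_∣_; ∣m∣n⇒∣m+n; ∣-refl)
open import Data.Nat.DivMod using (_mod_; m≡m%n+[m/n]*n; m/n*n≡m; m<n⇒m%n≡m; [m+kn]%n≡m%n)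
open import Data.Nat.GeneralisedArithmetic using (iterate)
open import Data.Nat.Tactic.RingSolver using (solve-∀)
open import Data.Nat.Properties using (m*n≢0; m*n≢0⇒m≢0; ≤-refl; ≤-trans; ≤-reflexive; +-mono-≤; +-monoˡ-≤; +-monoʳ-≤; *-mono-≤;
  *-monoˡ-≤; *-monoʳ-≤; *-comm; *-assoc; *-zeroʳ; *-identityˡ; *-identityʳ; *-distribˡ-+; +-suc; +-identityʳ;
  n≤1+n; <⇒≱; ≰⇒>; m≤m+n; m≤n+m; *-cancelˡ-≤; *-cancelˡ-≡; +-cancelˡ-≤; +-cancelʳ-≡; _≤?_; *-monoʳ-<; ≤-antisym; module ≤-Reasoning)
open import Data.Product using (Σ; ∃; ∃₂; _×_; _,_; proj₁; proj₂)
import Data.Product as Product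
open import Data.Product.Properties using (≡-dec)
open import Data.Rational using (_/_) renaming (_≤_ to _≤ℚ_)
import Data.Rational.Properties as ℚ
import Data.Rational.Unnormalised as ℚᵘ
import Data.Rational.Unnormalised.Properties as ℚᵘ
open import Data.Sign using (Sign; opposite)
import Data.Sign as Sign
open import Data.Sign.Properties using (opposite-involutive) renaming (_≟_ to _≟ˢ_)
open import Data.Sum using (_⊎_; inj₁; inj₂)
import Data.Sum as Sum
open import Data.Unit using (⊤; tt)
open import Data.Vec using (Vec; []; _∷_; lookup; here; there)
import Data.Vec as Vec
import Data.Vec.Properties as Vec
open import Function using (_∘_; _↔_; _⇔_; id; it; Inverse; mk↔ₛ′; mk⇔; Equivalence)
open import Relation.Binary.Definitions using (DecidableEquality)
open import Relation.Binary.PropositionalEquality hiding ([_])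
open import Relation.Nullary using (¬_; Dec; yes; no; contradiction; ¬?)
open import Relation.Nullary.Decidable using (map′; _×-dec_; _⊎-dec_; _→-dec_)
open import Relation.Unary using (Decidable)

-- The equations for a face say something only if its image steps do not simply repeat it, and two
-- coincidences could spoil this. An orientation-preserving `g` that fixes a code belongs to a
-- translation: it fixes every code, and the rotation at a neighbour of 0 settles the vertices in
-- `J`, which are not adjacent to 0. A reversing `g` may carry a face at 0 to the same two cells in
-- the opposite order, but only if `g w ≡ flip w`; being a reflection of the cycle, it cannot do so
-- at `flip w` as well. That nothing else can happen rests on rows and columns having at least three
-- cells, and on a row and a column sharing at most one.
--
-- The third code `u`, or its image, may also lie in a cell already in use. Only boundedly many `u`
-- do this; each is then paid for by a single equation, since there is no sum over N values to
-- compensate.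
--
-- The number `t` enters only through the `t` values that `a + b` can take in `J`, which makes the
-- constant quadratic in `t`. With fewer than 33 cells there is too little room for the swaps and
-- for a second face, and the bound is made trivial instead.

open Inverse using (to; from; strictlyInverseˡ; strictlyInverseʳ)

-- Counting

-- |P| ≤ K / M, for P that need not be decidable.
record Sparse {X : Set} (M : ℕ) (P : X → Set) (K : ℕ) : Set where
  field
    bound : ∀ {xs} → Unique xs → All P xs → M * length xs ≤ K

open Sparse

module _ {X : Set} where

  unique-⊆⇒length-≤ : {xs ys : List X} → Unique xs → (∀ {x} → x ∈ˡ xs → x ∈ˡ ys) → length xs ≤ length ys
  unique-⊆⇒length-≤ []             _     = z≤n
  unique-⊆⇒length-≤ {x ∷ xs} (x∉ ∷ u) xs⊆ys with ∈-∃++ (xs⊆ys (here refl))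
  ... | as , bs , refl = begin
    suc (length xs)          ≤⟨ s≤s (unique-⊆⇒length-≤ u sub) ⟩
    suc (length (as ++ bs))  ≡⟨ cong suc (length-++ as) ⟩
    suc (length as + length bs) ≡⟨ +-suc (length as) (length bs) ⟨
    length as + suc (length bs) ≡⟨ length-++ as ⟨
    length (as ++ x ∷ bs)    ∎
    where
    open ≤-Reasoning
    sub : ∀ {y} → y ∈ˡ xs → y ∈ˡ as ++ bs
    sub {y} y∈ with ∈-++⁻ as (xs⊆ys (there y∈))
    ... | inj₁ y∈as         = ∈-++⁺ˡ y∈as
    ... | inj₂ (here refl)  = contradiction refl (All.lookup x∉ y∈)
    ... | inj₂ (there y∈bs) = ∈-++⁺ʳ as y∈bs

  map-unique : {Y : Set} {f : X → Y} {xs : List X} →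
               (∀ {x y} → x ∈ˡ xs → y ∈ˡ xs → f x ≡ f y → x ≡ y) → Unique xs → Unique (map f xs)
  map-unique inj []       = []
  map-unique inj (x∉ ∷ u) =
    All.map⁺ (All.tabulate λ y∈ eq → All.lookup x∉ y∈ (inj (here refl) (there y∈) eq))
    ∷ map-unique (λ p q → inj (there p) (there q)) u

  -- Neither predicate need be decidable, so the list is split along the given witnesses. The
  -- inclusions into `xs` are carried through the induction to keep both parts unique.
  split-⊎ : {P Q : X → Set} {xs : List X} → Unique xs → All (λ x → P x ⊎ Q x) xs →
            ∃₂ λ ys zs → (Unique ys × All P ys × (∀ {x} → x ∈ˡ ys → x ∈ˡ xs))
                       × (Unique zs × All Q zs × (∀ {x} → x ∈ˡ zs → x ∈ˡ xs))
                       × length xs ≡ length ys + length zs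
  split-⊎ [] [] = [] , [] , ([] , [] , λ ()) , ([] , [] , λ ()) , refl
  split-⊎ {xs = x ∷ _} (x∉ ∷ u) (p ∷ ps) with split-⊎ u ps
  ... | ys , zs , (uy , py , y⊆) , (uz , qz , z⊆) , eq with p
  ...   | inj₁ px = x ∷ ys , zs
                  , (All.anti-mono y⊆ x∉ ∷ uy , px ∷ py , λ { (here e) → here e ; (there m) → there (y⊆ m) })
                  , (uz , qz , there ∘ z⊆) , cong suc eq
  ...   | inj₂ qx = ys , x ∷ zs , (uy , py , there ∘ y⊆)
                  , (All.anti-mono z⊆ x∉ ∷ uz , qx ∷ qz , λ { (here e) → here e ; (there m) → there (z⊆ m) })
                  , trans (cong suc eq) (sym (+-suc (length ys) (length zs)))

  module _ {M : ℕ} where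

    sparse-⊆ : {P Q : X → Set} {K : ℕ} → (∀ {x} → Q x → P x) → Sparse M P K → Sparse M Q K
    sparse-⊆ Q⊆P S .bound u q = S .bound u (All.map Q⊆P q)

    sparse-≤ : {P : X → Set} {K K′ : ℕ} → K ≤ K′ → Sparse M P K → Sparse M P K′
    sparse-≤ K≤K′ S .bound u p = ≤-trans (S .bound u p) K≤K′

    sparse-⊎ : {P Q : X → Set} {K L : ℕ} → Sparse M P K → Sparse M Q L →
               Sparse M (λ x → P x ⊎ Q x) (K + L)
    sparse-⊎ {K = K} {L} S S′ .bound {xs} u pq with split-⊎ u pq
    ... | ys , zs , (uy , py , _) , (uz , qz , _) , eq = begin
      M * length xs                  ≡⟨ cong (M *_) eq ⟩
      M * (length ys + length zs)    ≡⟨ *-distribˡ-+ M (length ys) (length zs) ⟩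
      M * length ys + M * length zs  ≤⟨ +-mono-≤ (S .bound uy py) (S′ .bound uz qz) ⟩
      K + L                          ∎
      where open ≤-Reasoning

    sparse-∅ : {P : X → Set} {K : ℕ} → (∀ {x} → ¬ P x) → Sparse M P K
    sparse-∅ ¬P .bound {[]}    _ _       = ≤-trans (≤-reflexive (*-zeroʳ M)) z≤n
    sparse-∅ ¬P .bound {_ ∷ _} _ (p ∷ _) = contradiction p ¬P

    sparse-⋃ : {I : Set} (is : List I) {P : I → X → Set} {K : ℕ} →
               (∀ {i} → i ∈ˡ is → Sparse M (P i) K) →
               Sparse M (λ x → ∃ λ i → i ∈ˡ is × P i x) (length is * K)
    sparse-⋃ []       S = sparse-∅ λ ()
    sparse-⋃ (i ∷ is) S = sparse-⊆
      (λ { (_ , here refl , p) → inj₁ p ; (j , there j∈ , p) → inj₂ (j , j∈ , p) })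
      (sparse-⊎ (S (here refl)) (sparse-⋃ is (S ∘ there)))

  sparse-∈ : (ys : List X) → Sparse 1 (_∈ˡ ys) (length ys)
  sparse-∈ ys .bound {xs} u ⊆ys = ≤-trans (≤-reflexive (*-identityˡ (length xs))) (unique-⊆⇒length-≤ {xs = xs} u (All.lookup ⊆ys))

  sparse-filter : {P : X → Set} {K : ℕ} (P? : Decidable P) → Sparse 1 P K → {xs : List X} → Unique xs →
                  length (filter P? xs) ≤ K
  sparse-filter P? S {xs} u = ≤-trans (≤-reflexive (sym (*-identityˡ _)))
    (S .bound (Unique.filter⁺ P? u) (All.all-filter P? xs))

  sparse-∃¬ : {P : X → Set} {K : ℕ} → Decidable P → Sparse 1 P K → {xs : List X} → Unique xs →
              K < length xs → ∃ λ x → ¬ P x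
  sparse-∃¬ P? S {xs} u K< with All.all? P? xs
  ... | yes ps = contradiction (S .bound u ps) (<⇒≱ (≤-trans K< (≤-reflexive (sym (*-identityˡ _)))))
  ... | no ¬ps with Any.satisfied (All.¬All⇒Any¬ P? xs ¬ps)
  ...   | x , ¬p = x , ¬p

  module _ (xs : List X) (complete : ∀ x → x ∈ˡ xs) {P : X → Set} (P? : Decidable P) where

    ∀? : Dec (∀ x → P x)
    ∀? = map′ (λ ps x → All.lookup ps (complete x)) (λ f → All.universal f xs) (All.all? P? xs)

    ∃? : Dec (∃ P)
    ∃? = map′ Any.satisfied (λ (x , p) → Any.map (λ { refl → p }) (complete x)) (Any.any? P? xs)

  allVecs : List X → (n : ℕ) → List (Vec X n)
  allVecs xs zero    = [ [] ]
  allVecs xs (suc n) = cartesianProductWith _∷_ xs (allVecs xs n)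

  ∈-allVecs : {xs : List X} → (∀ x → x ∈ˡ xs) → ∀ {n} (ys : Vec X n) → ys ∈ˡ allVecs xs n
  ∈-allVecs c []       = here refl
  ∈-allVecs c (y ∷ ys) = ∈-cartesianProductWith⁺ _∷_ (c y) (∈-allVecs c ys)

  enumerate : DecidableEquality X → {xs : List X} → (∀ x → x ∈ˡ xs) → {P : X → Set} → Decidable P → Enumeration P
  enumerate _≟′_ {xs} complete P? = record
    { elements = deduplicate _≟′_ (filter P? xs)
    ; unique   = DecUnique.deduplicate-! _≟′_ (filter P? xs)
    ; sound    = λ x∈ → proj₂ (∈-filter⁻ P? {xs = xs} (∈-deduplicate⁻ _≟′_ (filter P? xs) x∈))
    ; complete = λ p → ∈-deduplicate⁺ _≟′_ (∈-filter⁺ P? (complete _) p)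
    }

sparse-∘ : {X Y : Set} {M K : ℕ} {f : X → Y} {P : Y → Set} → (∀ {x y} → f x ≡ f y → x ≡ y) →
           Sparse M P K → Sparse M (P ∘ f) K
sparse-∘ {M = M} {K} {f} inj S .bound {xs} u p =
  subst (λ l → M * l ≤ K) (length-map f xs) (S .bound (Unique.map⁺ inj u) (All.map⁺ p))

∈-irrelevant : ∀ {n} {i : Fin n} {p : Subset n} (q r : i ∈ p) → q ≡ r
∈-irrelevant here      here      = refl
∈-irrelevant (there q) (there r) = cong there (∈-irrelevant q r)

members : ∀ {n} (p : Subset n) → List (∃ (_∈ p))
members []          = []
members (true  ∷ p) = (zero , here) ∷ map (λ (i , i∈) → Fin.suc i , there i∈) (members p)
members (false ∷ p) = map (λ (i , i∈) → Fin.suc i , there i∈) (members p)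

length-members : ∀ {n} (p : Subset n) → length (members p) ≡ ∣ p ∣
length-members []          = refl
length-members (true  ∷ p) = cong suc (trans (length-map _ (members p)) (length-members p))
length-members (false ∷ p) = trans (length-map _ (members p)) (length-members p)

∈-members : ∀ {n} {p : Subset n} {i} (i∈ : i ∈ p) → (i , i∈) ∈ˡ members p
∈-members {p = true  ∷ _} here       = here refl
∈-members {p = true  ∷ _} (there i∈) = there (∈-map⁺ _ (∈-members i∈))
∈-members {p = false ∷ _} (there i∈) = ∈-map⁺ _ (∈-members i∈)

members-unique : ∀ {n} (p : Subset n) → Unique (members p)
members-unique []          = []
members-unique (true  ∷ p) = All.map⁺ (All.tabulate λ _ ()) ∷ Unique.map⁺ (λ { refl → refl }) (members-unique p)
members-unique (false ∷ p) = Unique.map⁺ (λ { refl → refl }) (members-unique p)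

length-cartesianProduct : {X Y : Set} (xs : List X) (ys : List Y) →
                          length (cartesianProduct xs ys) ≡ length xs * length ys
length-cartesianProduct []       ys = refl
length-cartesianProduct (x ∷ xs) ys = trans (length-++ (map (x ,_) ys))
  (cong₂ _+_ (length-map (x ,_) ys) (length-cartesianProduct xs ys))

-- Cells, codes and arrays

signs : List Sign
signs = Sign.+ ∷ Sign.- ∷ []

∈-signs : ∀ s → s ∈ˡ signs
∈-signs Sign.+ = here refl
∈-signs Sign.- = there (here refl)

signs-unique : Unique signs
signs-unique = ((λ ()) ∷ []) ∷ [] ∷ []

module _ {m n : ℕ} {B : Cells m n} where

  open Cell

  Code : Set
  Code = Sign × Cell B

  cell-≡ : {c d : Cell B} → row c ≡ row d → col c ≡ col d → c ≡ d
  cell-≡ {cell i j p} {cell _ _ q} refl refl = cong (cell i j) (∈-irrelevant p q)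

  infix 4 _≟ᶜ_ _≟ʷ_

  _≟ᶜ_ : DecidableEquality (Cell B)
  c ≟ᶜ d = map′ (λ (p , q) → cell-≡ p q) (λ eq → cong row eq , cong col eq)
                ((row c ≟ row d) ×-dec (col c ≟ col d))

  _≟ʷ_ : DecidableEquality Code
  _≟ʷ_ = ≡-dec _≟ˢ_ _≟ᶜ_

  column⇒row : ∀ {i j} → i ∈ column B j → j ∈ lookup B i
  column⇒row {i} {j} i∈ = Vec.lookup⇒[]= j (lookup B i)
    (trans (sym (Vec.lookup-map i (λ r → lookup r j) B)) (Vec.[]=⇒lookup i∈))

  row⇒column : ∀ {i j} → j ∈ lookup B i → i ∈ column B j
  row⇒column {i} {j} j∈ = Vec.lookup⇒[]= i (column B j)
    (trans (Vec.lookup-map i (λ r → lookup r j) B) (Vec.[]=⇒lookup j∈))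

  rowCells : Fin m → List (Cell B)
  rowCells i = map (λ (j , j∈) → cell i j j∈) (members (lookup B i))

  columnCells : Fin n → List (Cell B)
  columnCells j = map (λ (i , i∈) → cell i j (column⇒row i∈)) (members (column B j))

  ∈-columnCells : ∀ c → c ∈ˡ columnCells (col c)
  ∈-columnCells (cell i j p) =
    subst (_∈ˡ columnCells j) (cell-≡ refl refl) (∈-map⁺ _ (∈-members (row⇒column p)))

  rowCells-row : ∀ {i c} → c ∈ˡ rowCells i → row c ≡ i
  rowCells-row c∈ with ∈-map⁻ _ c∈
  ... | _ , _ , refl = refl

  columnCells-col : ∀ {j c} → c ∈ˡ columnCells j → col c ≡ j
  columnCells-col c∈ with ∈-map⁻ _ c∈
  ... | _ , _ , refl = refl

  rowCells-unique : ∀ i → Unique (rowCells i)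
  rowCells-unique i = Unique.map⁺ (λ { refl → refl }) (members-unique (lookup B i))

  columnCells-unique : ∀ j → Unique (columnCells j)
  columnCells-unique j = Unique.map⁺ inj (members-unique (column B j))
    where
    inj : ∀ {x y : ∃ (_∈ column B j)} → _≡_ {A = Cell B} (cell (proj₁ x) j (column⇒row (proj₂ x))) (cell (proj₁ y) j (column⇒row (proj₂ y))) → x ≡ y
    inj {i , p} {i′ , q} eq with cong row eq
    ... | refl = cong (i ,_) (∈-irrelevant p q)

  length-rowCells : ∀ i → length (rowCells i) ≡ ∣ lookup B i ∣
  length-rowCells i = trans (length-map _ (members (lookup B i))) (length-members (lookup B i))

  length-columnCells : ∀ j → length (columnCells j) ≡ ∣ column B j ∣
  length-columnCells j = trans (length-map _ (members (column B j))) (length-members (column B j))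

  allCells : List (Cell B)
  allCells = concat (map columnCells (allFin n))

  ∈-allCells : ∀ c → c ∈ˡ allCells
  ∈-allCells c = ∈-concat⁺′ (∈-columnCells c) (∈-map⁺ columnCells (∈-allFin (col c)))

  allCells-unique : Unique allCells
  allCells-unique = Unique.concat⁺
    (All.map⁺ (All.universal columnCells-unique (allFin n)))
    (AllPairs.map⁺ (AllPairs.map disjoint (Unique.allFin⁺ n)))
    where
    disjoint : ∀ {i j} → i ≢ j → ∀ {c} → ¬ (c ∈ˡ columnCells i × c ∈ˡ columnCells j)
    disjoint i≢j (c∈i , c∈j) = i≢j (trans (sym (columnCells-col c∈i)) (columnCells-col c∈j))

  length-allCells : ∀ {k} → (∀ j → ∣ column B j ∣ ≡ k) → length allCells ≡ n * k
  length-allCells {k} columns = trans (lemma (allFin n)) (cong (_* k) (length-tabulate {n = n} id))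
    where
    lemma : ∀ js → length (concat (map columnCells js)) ≡ length js * k
    lemma []       = refl
    lemma (j ∷ js) = trans (length-++ (columnCells j))
      (cong₂ _+_ (trans (length-columnCells j) (columns j)) (lemma js))

  allCodes : List Code
  allCodes = cartesianProduct signs allCells

  ∈-allCodes : ∀ w → w ∈ˡ allCodes
  ∈-allCodes (s , c) = ∈-cartesianProduct⁺ (∈-signs s) (∈-allCells c)

  allCodes-unique : Unique allCodes
  allCodes-unique = Unique.cartesianProduct⁺ signs-unique allCells-unique

  neg : Code → Code
  neg (s , c) = opposite s , c

  neg-involutive : ∀ w → neg (neg w) ≡ w
  neg-involutive (s , c) = cong (_, c) (opposite-involutive s)

  swapCells : Cell B → Cell B → Cell B → Cell B
  swapCells p q c with c ≟ᶜ p | c ≟ᶜ q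
  ... | yes _ | _     = q
  ... | no _  | yes _ = p
  ... | no _  | no _  = c

  swapCells-right : ∀ p q → swapCells p q q ≡ p
  swapCells-right p q with q ≟ᶜ p | q ≟ᶜ q
  ... | yes q≡p | _       = q≡p
  ... | no _    | yes _   = refl
  ... | no _    | no q≢q  = contradiction refl q≢q

  swapCells-left : ∀ p q → swapCells p q p ≡ q
  swapCells-left p q with p ≟ᶜ p | p ≟ᶜ q
  ... | yes _   | _ = refl
  ... | no p≢p  | _ = contradiction refl p≢p

  swapCells-other : ∀ {p q c} → c ≢ p → c ≢ q → swapCells p q c ≡ c
  swapCells-other {p} {q} {c} c≢p c≢q with c ≟ᶜ p | c ≟ᶜ q
  ... | yes c≡p | _       = contradiction c≡p c≢p
  ... | no _    | yes c≡q = contradiction c≡q c≢q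
  ... | no _    | no _    = refl

  swapCells-involutive : ∀ p q c → swapCells p q (swapCells p q c) ≡ c
  swapCells-involutive p q c with c ≟ᶜ p | c ≟ᶜ q
  ... | yes refl | _       = swapCells-right p q
  ... | no _    | yes refl = swapCells-left p q
  ... | no c≢p  | no c≢q   = swapCells-other c≢p c≢q

lookup-ext : {X : Set} {n : ℕ} {xs ys : Vec X n} → (∀ i → lookup xs i ≡ lookup ys i) → xs ≡ ys
lookup-ext {xs = xs} {ys} eq =
  trans (sym (Vec.tabulate∘lookup xs)) (trans (Vec.tabulate-cong eq) (Vec.tabulate∘lookup ys))

module _ {v m n : ℕ} where

  skel-lookup : (A : PFArray v m n) → ∀ i j → lookup (lookup (skel A) i) j ≡ is-just (lookup (lookup A i) j)
  skel-lookup A i j = trans (cong (λ r → lookup r j) (Vec.lookup-map i (Vec.map is-just) A))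
                            (Vec.lookup-map j is-just (lookup A i))

module _ {v m n : ℕ} .{{_ : NonZero v}} {B : Cells m n} where

  open Cell

  -- Entries are read at cells of the fixed `B`, so that arrays can be compared without transport
  -- along `skel A ≡ B`. When that equation holds the default `0ᵥ` is never reached.
  at : PFArray v m n → Cell B → Fin v
  at A c = fromMaybe 0ᵥ (lookup (lookup A (row c)) (col c))

  value : PFArray v m n → Code {B = B} → Fin v
  value A (s , c) = signed s (at A c)

  value-neg : ∀ A w → value A (neg w) ≡ -ᵥ value A w
  value-neg A (Sign.+ , c) = refl
  value-neg A (Sign.- , c) = sym (-ᵥ-involutive (at A c))

  fillAt : (Cell B → Fin v) → ∀ i j → Maybe (Fin v)
  fillAt f i j with j ∈? lookup B i
  ... | yes j∈ = just (f (cell i j j∈))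
  ... | no _   = nothing

  fill : (Cell B → Fin v) → PFArray v m n
  fill f = Vec.tabulate λ i → Vec.tabulate (fillAt f i)

  lookup-fill : ∀ f i j → lookup (lookup (fill f) i) j ≡ fillAt f i j
  lookup-fill f i j = trans (cong (λ r → lookup r j) (Vec.lookup∘tabulate _ i)) (Vec.lookup∘tabulate _ j)

  at-fill : ∀ f c → at (fill f) c ≡ f c
  at-fill f (cell i j p) rewrite lookup-fill f i j with j ∈? lookup B i
  ... | yes j∈ = cong (f ∘ cell i j) (∈-irrelevant j∈ p)
  ... | no j∉  = contradiction p j∉

  skel-fill : ∀ f → skel (fill f) ≡ B
  skel-fill f = lookup-ext λ i → lookup-ext λ j →
    trans (skel-lookup (fill f) i j) (trans (cong is-just (lookup-fill f i j)) (lemma i j))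
    where
    lemma : ∀ i j → is-just (fillAt f i j) ≡ lookup (lookup B i) j
    lemma i j with j ∈? lookup B i
    ... | yes j∈ = sym (Vec.[]=⇒lookup j∈)
    ... | no j∉ with lookup (lookup B i) j in eq
    ...   | false = refl
    ...   | true  = contradiction (Vec.lookup⇒[]= j (lookup B i) eq) j∉

  at-ext : {A A′ : PFArray v m n} → skel A ≡ B → skel A′ ≡ B → (∀ c → at A c ≡ at A′ c) → A ≡ A′
  at-ext {A} {A′} sA sA′ eq = lookup-ext λ i → lookup-ext λ j → lemma i j
    where
    sk : ∀ {C} → skel C ≡ B → ∀ i j → is-just (lookup (lookup C i) j) ≡ lookup (lookup B i) j
    sk {C} s i j = trans (sym (skel-lookup C i j)) (cong (λ D → lookup (lookup D i) j) s)
    lemma : ∀ i j → lookup (lookup A i) j ≡ lookup (lookup A′ i) j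
    lemma i j with lookup (lookup A i) j in eqA | lookup (lookup A′ i) j in eqA′ | sk {A} sA i j | sk {A′} sA′ i j
    ... | nothing | nothing | _ | _ = refl
    ... | just _  | nothing | p | q = contradiction (trans p (sym q)) λ ()
    ... | nothing | just _  | p | q = contradiction (trans p (sym q)) λ ()
    ... | just x  | just y  | p | _ = cong just (trans (sym (cong (fromMaybe 0ᵥ) eqA))
      (trans (eq (cell i j (Vec.lookup⇒[]= j (lookup B i) (sym p)))) (cong (fromMaybe 0ᵥ) eqA′)))

  swap : Cell B → Cell B → PFArray v m n → PFArray v m n
  swap p q A = fill (at A ∘ swapCells p q)

  at-swap : ∀ p q A c → at (swap p q A) c ≡ at A (swapCells p q c)
  at-swap p q A = at-fill (at A ∘ swapCells p q)

  -- Membership in `𝒜` reduced to a bijection from the cells of `B` to `Ω`, the form that is visibly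
  -- preserved by swapping entries. `𝒜⇒filling` and `filling⇒𝒜` translate.
  record Filling (Ω : Subset v) (A : PFArray v m n) : Set where
    field
      skeleton  : skel A ≡ B
      injective : ∀ {c d} → at A c ≡ at A d → c ≡ d
      at∈Ω      : ∀ c → at A c ∈ Ω
      onto      : ∀ {x} → x ∈ Ω → ∃ λ c → at A c ≡ x

  swap-filling : ∀ {Ω A} p q → Filling Ω A → Filling Ω (swap p q A)
  swap-filling {Ω} {A} p q F = record
    { skeleton  = skel-fill _
    ; injective = λ {c} {d} eq → trans (sym (swapCells-involutive p q c)) (trans
        (cong (swapCells p q) (injective (trans (sym (at-swap p q A c)) (trans eq (at-swap p q A d)))))
        (swapCells-involutive p q d))
    ; at∈Ω      = λ c → subst (_∈ Ω) (sym (at-swap p q A c)) (at∈Ω (swapCells p q c))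
    ; onto      = λ x∈ → let c , eq = onto x∈ in
        swapCells p q c , trans (at-swap p q A (swapCells p q c)) (trans (cong (at A) (swapCells-involutive p q c)) eq)
    }
    where open Filling F

entry-at : ∀ {v m n} .{{_ : NonZero v}} (A : PFArray v m n) (c : Cell (skel A)) → entry A c ≡ at A c
entry-at (r ∷ _) (cell zero j p) = rowEntry-lookup r p
  where
  rowEntry-lookup : ∀ {n} (r : Vec (Maybe (Fin _)) n) {j} (p : j ∈ Vec.map is-just r) →
                    rowEntry r p ≡ fromMaybe 0ᵥ (lookup r j)
  rowEntry-lookup (just x  ∷ _) here      = refl
  rowEntry-lookup (just _  ∷ r) (there p) = rowEntry-lookup r p
  rowEntry-lookup (nothing ∷ r) (there p) = rowEntry-lookup r p
entry-at (_ ∷ A) (cell (Fin.suc i) j p) = entry-at A (cell i j p)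

-- Triangular systems of equations between entries

infix 4 _#_

_#_ : {X : Set} → X → List X → Set
x # xs = All (x ≢_) xs

#-⊆ : {X : Set} {x : X} {xs ys : List X} → (∀ {y} → y ∈ˡ xs → y ∈ˡ ys) → x # ys → x # xs
#-⊆ sub x#ys = All.tabulate λ y∈ → All.lookup x#ys (sub y∈)

module _ {v : ℕ} .{{_ : NonZero v}} where

  signed-injective : ∀ s {x y : Fin v} → signed s x ≡ signed s y → x ≡ y
  signed-injective Sign.+         eq = eq
  signed-injective Sign.- {x} {y} eq = trans (sym (-ᵥ-involutive x)) (trans (cong (-ᵥ_) eq) (-ᵥ-involutive y))

  x+y≡z⇒x≡z-y : {x y z : Fin v} → x +ᵥ y ≡ z → x ≡ z -ᵥ y
  x+y≡z⇒x≡z-y {x} {y} refl = sym (trans (cong (_-ᵥ y) (+ᵥ-comm x y)) ([x+y]-x≡y y x))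

module Systems {v m n : ℕ} .{{_ : NonZero v}} (B : Cells m n) (Ω : Subset v)
               (outcomes : Enumeration (Filling {B = B} Ω)) where

  N T : ℕ
  N = length (allCells {B = B})
  T = Enumeration.size outcomes

  sparse-filling : Sparse 1 (Filling Ω) T
  sparse-filling = sparse-⊆ (Enumeration.complete outcomes) (sparse-∈ (Enumeration.elements outcomes))

  -- A swapping argument: from A with E A and the N - |R| ≥ N / 2 cells q ∉ R we get arrays
  -- swap p q A with Q, and A is recovered from such an array because E fixes the entry in p.
  swap-sparse : {M K : ℕ} {E Q : PFArray v m n → Set} (p : Cell B) (R : List (Cell B)) →
    p # R → 2 * length R ≤ N →
    (∀ {A} → E A → Filling Ω A) →
    (∀ {A} → E A → ∀ q → q # R → Q (swap p q A)) →
    (∀ {A A′} → E A → E A′ → (∀ {r} → r ∈ˡ R → at A r ≡ at A′ r) → at A p ≡ at A′ p) →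
    Sparse M Q K → Sparse (N * M) E (2 * K)
  swap-sparse {M} {K} {E} {Q} p R p#R R≤ filling closed determined S .bound {xs} u es = begin
    N * M * length xs                            ≤⟨ *-monoˡ-≤ (length xs) (*-monoˡ-≤ M N≤) ⟩
    2 * length zs * M * length xs                ≡⟨ cong (_* length xs) (trans (*-assoc 2 (length zs) M) (cong (2 *_) (*-comm (length zs) M))) ⟩
    2 * (M * length zs) * length xs              ≡⟨ *-assoc 2 (M * length zs) (length xs) ⟩
    2 * (M * length zs * length xs)              ≡⟨ cong (2 *_) (trans (*-assoc M (length zs) (length xs)) (cong (M *_) (*-comm (length zs) (length xs)))) ⟩
    2 * (M * (length xs * length zs))            ≡⟨ cong (λ l → 2 * (M * l)) (trans (length-map _ pairs) (length-cartesianProduct xs zs)) ⟨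
    2 * (M * length (map (λ (A , q) → swap p q A) pairs)) ≤⟨ *-monoʳ-≤ 2 (S .bound unique all-Q) ⟩
    2 * K                                        ∎
    where
    open ≤-Reasoning
    outside? : Decidable (_# R)
    outside? q = All.all? (λ r → ¬? (q ≟ᶜ r)) R
    zs = filter outside? allCells
    pairs = cartesianProduct xs zs
    N≤R+zs : N ≤ length R + length zs
    N≤R+zs = ≤-trans (unique-⊆⇒length-≤ allCells-unique sub) (≤-reflexive (length-++ R))
      where
      sub : ∀ {c} → c ∈ˡ allCells → c ∈ˡ R ++ zs
      sub {c} c∈ with DecMembership._∈?_ _≟ᶜ_ c R
      ... | yes c∈R = ∈-++⁺ˡ c∈R
      ... | no  c∉R = ∈-++⁺ʳ R (∈-filter⁺ outside? c∈ (All.¬Any⇒All¬ R c∉R))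
    N≤ : N ≤ 2 * length zs
    N≤ = +-cancelˡ-≤ N N (2 * length zs) (begin
      N + N                         ≡⟨ cong (λ z → N + z) (+-identityʳ N) ⟨
      2 * N                         ≤⟨ *-monoʳ-≤ 2 N≤R+zs ⟩
      2 * (length R + length zs)    ≡⟨ *-distribˡ-+ 2 (length R) (length zs) ⟩
      2 * length R + 2 * length zs  ≤⟨ +-monoˡ-≤ _ R≤ ⟩
      N + 2 * length zs             ∎)
    E∈ : ∀ {A q} → (A , q) ∈ˡ pairs → E A × q # R
    E∈ Aq∈ = let A∈ , q∈ = ∈-cartesianProduct⁻ xs zs Aq∈
             in All.lookup es A∈ , proj₂ (∈-filter⁻ outside? {xs = allCells} q∈)
    all-Q : All Q (map (λ (A , q) → swap p q A) pairs)
    all-Q = All.map⁺ (All.tabulate λ Aq∈ → let EA , q# = E∈ Aq∈ in closed EA _ q#)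
    recover : ∀ {A q A′ q′} → E A × q # R → E A′ × q′ # R → swap p q A ≡ swap p q′ A′ → (A , q) ≡ (A′ , q′)
    recover {A} {q} {A′} {q′} (EA , q#) (EA′ , q′#) eq = cong₂ _,_ A≡A′ q≡q′
      where
      module F = Filling (filling EA)
      at-eq : ∀ c → at A (swapCells p q c) ≡ at A′ (swapCells p q′ c)
      at-eq c = trans (sym (at-swap p q A c)) (trans (cong (λ D → at D c) eq) (at-swap p q′ A′ c))
      agree : ∀ {r} → r ∈ˡ R → at A r ≡ at A′ r
      agree {r} r∈ = trans (cong (at A) (sym (swapCells-other (All.lookup p#R r∈ ∘ sym) (All.lookup q# r∈ ∘ sym))))
        (trans (at-eq r) (cong (at A′) (swapCells-other (All.lookup p#R r∈ ∘ sym) (All.lookup q′# r∈ ∘ sym))))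
      -- The common swapped array holds the old entry of `p` in the cell `q`, and equally in `q′`.
      -- The two old entries agree because the swaps did not touch `R`, and a filling has no
      -- repeated entry.
      q≡q′ : q ≡ q′
      q≡q′ = Filling.injective (swap-filling p q (filling EA))
        (trans (trans (at-swap p q A q) (cong (at A) (swapCells-right p q)))
        (trans (determined EA EA′ agree)
        (trans (sym (trans (at-swap p q′ A′ q′) (cong (at A′) (swapCells-right p q′))))
               (cong (λ D → at D q′) (sym eq)))))
      A≡A′ : A ≡ A′
      A≡A′ = at-ext F.skeleton (Filling.skeleton (filling EA′)) λ c →
        trans (cong (at A) (sym (swapCells-involutive p q c)))
        (trans (at-eq (swapCells p q c))
        (trans (cong (λ r → at A′ (swapCells p r (swapCells p q c))) (sym q≡q′))
               (cong (at A′) (swapCells-involutive p q c))))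
    unique : Unique (map (λ (A , q) → swap p q A) pairs)
    unique = map-unique (λ x∈ y∈ → recover (E∈ x∈) (E∈ y∈))
      (Unique.cartesianProduct⁺ u (Unique.filter⁺ outside? allCells-unique))

  record Equation : Set where
    constructor equation
    field
      pivot : Code {B = B}
      rest  : List (Code {B = B})
      const : Fin v

    support cells : List (Cell B)
    support = map proj₂ rest
    cells   = proj₂ pivot ∷ support

  open Equation

  rhs : PFArray v m n → Fin v → List (Code {B = B}) → Fin v
  rhs A x []       = x
  rhs A x (w ∷ ws) = rhs A (x +ᵥ value A w) ws

  Holds : PFArray v m n → Equation → Set
  Holds A e = value A (pivot e) ≡ rhs A (const e) (rest e)

  cellsOf : List Equation → List (Cell B)
  cellsOf = concatMap cells

  Triangular : List Equation → Set
  Triangular []       = ⊤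
  Triangular (e ∷ es) = proj₂ (pivot e) # (support e ++ cellsOf es) × Triangular es

  rhs-local : ∀ {A A′} x ws → (∀ {c} → c ∈ˡ map proj₂ ws → at A c ≡ at A′ c) → rhs A x ws ≡ rhs A′ x ws
  rhs-local x []             eq = refl
  rhs-local {A} x ((s , c) ∷ ws) eq =
    trans (rhs-local (x +ᵥ value A (s , c)) ws (eq ∘ there)) (cong (λ y → rhs _ (x +ᵥ signed s y) ws) (eq (here refl)))

  holds-local : ∀ {A A′} e → (∀ {c} → c ∈ˡ cells e → at A c ≡ at A′ c) → Holds A e → Holds A′ e
  holds-local (equation (s , p) ws x) eq h =
    trans (cong (signed s) (sym (eq (here refl)))) (trans h (rhs-local x ws (eq ∘ there)))

  -- Moving the entry of the first pivot to a cell outside `R` leaves the later equations intact, as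
  -- they read only cells of `R`; and the first equation recovers that entry from `R`. So each
  -- equation gains a factor N and loses a factor 2, the latter because only the at least N / 2
  -- cells outside `R` are used.
  triangular-sparse : ∀ es → Triangular es → 2 * length (cellsOf es) ≤ N →
    Sparse (N ^ length es) (λ A → Filling Ω A × All (Holds A) es) (2 ^ length es * T)
  triangular-sparse [] _ _ = sparse-⊆ proj₁ (sparse-≤ (m≤m+n T 0) sparse-filling)
  triangular-sparse (e@(equation (s , p) ws x) ∷ es) (p# , tri) small =
    sparse-≤ (≤-reflexive (sym (*-assoc 2 (2 ^ length es) T)))
      (swap-sparse p R p# (≤-trans (*-monoʳ-≤ 2 (n≤1+n (length R))) small) proj₁ closed determined
        (triangular-sparse es tri (≤-trans (*-monoʳ-≤ 2
          (≤-trans (m≤n+m (length (cellsOf es)) (length (cells e))) (≤-reflexive (sym (length-++ (cells e)))))) small)))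
    where
    R = support e ++ cellsOf es
    closed : ∀ {A} → Filling Ω A × All (Holds A) (e ∷ es) → ∀ q → q # R →
             Filling Ω (swap p q A) × All (Holds (swap p q A)) es
    closed {A} (F , _ ∷ hs) q q# = swap-filling p q F , All.tabulate λ {e′} e′∈ →
      holds-local e′ (λ c∈ → let c∈R = ∈-++⁺ʳ (support e) (∈-concat⁺′ c∈ (∈-map⁺ cells e′∈)) in
        sym (trans (at-swap p q A _) (cong (at A) (swapCells-other (All.lookup p# c∈R ∘ sym) (All.lookup q# c∈R ∘ sym)))))
        (All.lookup hs e′∈)
    determined : ∀ {A A′} → Filling Ω A × All (Holds A) (e ∷ es) → Filling Ω A′ × All (Holds A′) (e ∷ es) →
                 (∀ {r} → r ∈ˡ R → at A r ≡ at A′ r) → at A p ≡ at A′ p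
    determined (_ , h ∷ _) (_ , h′ ∷ _) eq =
      signed-injective s (trans h (trans (rhs-local x ws (eq ∘ ∈-++⁺ˡ)) (sym h′)))

-- Faces through the vertex 0

module _ {v : ℕ} .{{_ : NonZero v}} where

  signed-+ᵥ : ∀ s (x y : Fin v) → signed s (x +ᵥ y) ≡ signed s x +ᵥ signed s y
  signed-+ᵥ Sign.+ x y = refl
  signed-+ᵥ Sign.- x y = sym (-ᵥ-+ᵥ-comm x y)

  signed-signed : ∀ s (x : Fin v) → signed s (signed s x) ≡ x
  signed-signed Sign.+ x = refl
  signed-signed Sign.- x = -ᵥ-involutive x

  module _ {m n : ℕ} {B : Cells m n} where

    turn : Sign → Code {B = B} → Code
    turn s (s′ , c) = s Sign.* s′ , c

    value-turn : ∀ A s w → value A (turn s w) ≡ signed s (value A w)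
    value-turn A Sign.+ w = refl
    value-turn A Sign.- w = value-neg A w

    same-cell⇒turn : ∀ {w w′ : Code {B = B}} → proj₂ w ≡ proj₂ w′ → ∃ λ s → w ≡ turn s w′
    same-cell⇒turn {Sign.+ , _} {Sign.+ , _} refl = Sign.+ , refl
    same-cell⇒turn {Sign.+ , _} {Sign.- , _} refl = Sign.- , refl
    same-cell⇒turn {Sign.- , _} {Sign.+ , _} refl = Sign.- , refl
    same-cell⇒turn {Sign.- , _} {Sign.- , _} refl = Sign.+ , refl

module Bases {v m n : ℕ} .{{_ : NonZero v}} (B : Cells m n) (Ω : Subset v)
             (outcomes : Enumeration (Filling {B = B} Ω))
             (32≤N : 32 ≤ length (allCells {B = B})) where

  open Systems B Ω outcomes
  open Equation

  -- Two consecutive steps a, b along a face through the vertex 0, and their images a′, b′ under an automorphism.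
  record Base : Set where
    field
      a b a′ b′     : Code {B = B}
      a≢b           : proj₂ a ≢ proj₂ b
      nondegenerate : (proj₂ a ≢ proj₂ a′ × proj₂ a ≢ proj₂ b′) ⊎ (proj₂ b ≢ proj₂ a′ × proj₂ b ≢ proj₂ b′)

    base : List (Cell B)
    base = proj₂ a ∷ proj₂ b ∷ proj₂ a′ ∷ proj₂ b′ ∷ []

  open Base

  -- A value of a + b: an element of J, or the signed entry at a code.
  Third : Set
  Third = Fin v ⊎ Code {B = B}

  thirdValue : PFArray v m n → Third → Fin v
  thirdValue A (inj₁ j) = j
  thirdValue A (inj₂ u) = value A u

  thirdCell : Third → List (Cell B)
  thirdCell (inj₁ _) = []
  thirdCell (inj₂ u) = [ proj₂ u ]

  SumIs : Base → Third → PFArray v m n → Set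
  SumIs β o A = value A (a β) +ᵥ value A (b β) ≡ thirdValue A o

  Closes : (Code {B = B} → Code {B = B}) → Base → Code {B = B} → PFArray v m n → Set
  Closes g β u A = SumIs β (inj₂ u) A × value A (a′ β) +ᵥ value A (b′ β) ≡ value A (g u)

  Small : Equation → Set
  Small e = length (rest e) ≤ 3

  small-cellsOf : ∀ {es} → All Small es → length (cellsOf es) ≤ length es * 4
  small-cellsOf []                       = z≤n
  small-cellsOf {es = e ∷ es} (le ∷ les) = ≤-trans (≤-reflexive (length-++ (cells e)))
    (+-mono-≤ (s≤s (≤-trans (≤-reflexive (length-map proj₂ (rest e))) le)) (small-cellsOf les))

  -- At most four equations with at most four cells each: twice these 16 cells is the 32 required of
  -- N.
  system-sparse : ∀ {P : PFArray v m n → Set} es → Triangular es → All Small es → length es ≤ 4 → (∀ {A} → P A → All (Holds A) es) →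
                  Sparse (N ^ length es) (λ A → Filling Ω A × P A) (2 ^ length es * T)
  system-sparse es tri small ≤4 holds = sparse-⊆ (λ (F , p) → F , holds p)
    (triangular-sparse es tri (≤-trans (*-monoʳ-≤ 2 (≤-trans (small-cellsOf small) (*-monoˡ-≤ 4 ≤4))) 32≤N))

  -- The sum is solved for its first argument, so the order of the arguments selects the pivot.
  sumEq : Code {B = B} → Code {B = B} → Third → Equation
  sumEq p q (inj₁ j) = equation p [ neg q ] j
  sumEq p q (inj₂ u) = equation p (u ∷ neg q ∷ []) 0ᵥ

  pivot-sumEq : ∀ p q o → pivot (sumEq p q o) ≡ p
  pivot-sumEq p q (inj₁ _) = refl
  pivot-sumEq p q (inj₂ _) = refl

  support-sumEq : ∀ p q o → support (sumEq p q o) ≡ thirdCell o ++ [ proj₂ q ]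
  support-sumEq p q (inj₁ _) = refl
  support-sumEq p q (inj₂ _) = refl

  small-sumEq : ∀ p q o → Small (sumEq p q o)
  small-sumEq p q (inj₁ _) = s≤s z≤n
  small-sumEq p q (inj₂ _) = s≤s (s≤s z≤n)

  holds-sumEq : ∀ {A} p q o → value A p +ᵥ value A q ≡ thirdValue A o → Holds A (sumEq p q o)
  holds-sumEq {A} p q (inj₁ j) eq = trans (x+y≡z⇒x≡z-y eq) (cong (j +ᵥ_) (sym (value-neg A q)))
  holds-sumEq {A} p q (inj₂ u) eq = trans (x+y≡z⇒x≡z-y eq)
    (cong₂ _+ᵥ_ (sym (+ᵥ-identityˡ (value A u))) (sym (value-neg A q)))

  triangular-sumEq : ∀ p q o {es} → proj₂ p # thirdCell o → proj₂ p ≢ proj₂ q → proj₂ p # cellsOf es →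
                     Triangular es → Triangular (sumEq p q o ∷ es)
  triangular-sumEq p q o p#o p≢q p#es tri
    rewrite support-sumEq p q o | pivot-sumEq p q o = All.++⁺ (All.++⁺ p#o (p≢q ∷ [])) p#es , tri

  cells-sumEq : ∀ p q o {c} → c ∈ˡ cells (sumEq p q o) → c ∈ˡ proj₂ p ∷ proj₂ q ∷ thirdCell o
  cells-sumEq p q (inj₁ _) (here eq)                 = here eq
  cells-sumEq p q (inj₁ _) (there (here eq))         = there (here eq)
  cells-sumEq p q (inj₂ _) (here eq)                 = here eq
  cells-sumEq p q (inj₂ _) (there (here eq))         = there (there (here eq))
  cells-sumEq p q (inj₂ _) (there (there (here eq))) = there (here eq)

  avoid-one : ∀ {c d} o → c ≢ d → c # thirdCell o ⊎ d # thirdCell o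
  avoid-one (inj₁ _)     _   = inj₁ []
  avoid-one {c} (inj₂ u) c≢d with c ≟ᶜ proj₂ u
  ... | no c≢u   = inj₁ (c≢u ∷ [])
  ... | yes refl = inj₂ ((c≢d ∘ sym) ∷ [])

  module _ {P : PFArray v m n → Set} (o o′ : Third) where

    -- The equation with pivot `r` heads the system, so `r` has to avoid both equations, while `p`
    -- only has to avoid the rest of its own. This leaves room for `s` and `o′` to meet the cells of
    -- the other sum.
    two-sums-sparse-pivot : ∀ p q r s →
      (∀ {A} → P A → value A p +ᵥ value A q ≡ thirdValue A o) →
      (∀ {A} → P A → value A r +ᵥ value A s ≡ thirdValue A o′) →
      proj₂ p ≢ proj₂ q → proj₂ r ≢ proj₂ s → proj₂ r ≢ proj₂ p → proj₂ r ≢ proj₂ q →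
      proj₂ p # thirdCell o → proj₂ r # thirdCell o → proj₂ r # thirdCell o′ →
      Sparse (N ^ 2) (λ A → Filling Ω A × P A) (4 * T)
    two-sums-sparse-pivot p q r s h h′ p≢q r≢s r≢p r≢q p#o r#o r#o′ =
      system-sparse {P} (sumEq r s o′ ∷ sumEq p q o ∷ [])
        (triangular-sumEq r s o′ {[ sumEq p q o ]} r#o′ r≢s (#-⊆ sub (r≢p ∷ r≢q ∷ r#o))
          (triangular-sumEq p q o {[]} p#o p≢q [] tt))
        (small-sumEq r s o′ ∷ small-sumEq p q o ∷ []) (s≤s (s≤s z≤n))
        (λ {A} pA → holds-sumEq {A} r s o′ (h′ pA) ∷ holds-sumEq {A} p q o (h pA) ∷ [])
      where
      sub : ∀ {c} → c ∈ˡ cellsOf (sumEq p q o ∷ []) → c ∈ˡ proj₂ p ∷ proj₂ q ∷ thirdCell o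
      sub c∈ with ∈-++⁻ (cells (sumEq p q o)) c∈
      ... | inj₁ c∈′ = cells-sumEq p q o c∈′

    two-sums-sparse-pair : ∀ p q r s →
      (∀ {A} → P A → value A p +ᵥ value A q ≡ thirdValue A o) →
      (∀ {A} → P A → value A r +ᵥ value A s ≡ thirdValue A o′) →
      proj₂ p ≢ proj₂ q → proj₂ r ≢ proj₂ s → proj₂ r ≢ proj₂ p → proj₂ r ≢ proj₂ q →
      proj₂ r # thirdCell o → proj₂ r # thirdCell o′ →
      Sparse (N ^ 2) (λ A → Filling Ω A × P A) (4 * T)
    two-sums-sparse-pair p q r s h h′ p≢q r≢s r≢p r≢q r#o r#o′ with avoid-one o p≢q
    ... | inj₁ p#o = two-sums-sparse-pivot p q r s h h′ p≢q r≢s r≢p r≢q p#o r#o r#o′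
    ... | inj₂ q#o = two-sums-sparse-pivot q p r s (λ {A} pA → trans (+ᵥ-comm (value A q) (value A p)) (h pA)) h′
                       (p≢q ∘ sym) r≢s r≢q r≢p q#o r#o r#o′

  avoid-two : ∀ o o′ {cs} → Unique cs → 3 ≤ length cs → Any.Any (_# (thirdCell o ++ thirdCell o′)) cs
  avoid-two o o′ {cs} u 3≤ with Any.any? (λ c → All.all? (λ d → ¬? (c ≟ᶜ d)) thirds) cs
    where thirds = thirdCell o ++ thirdCell o′
  ... | yes found = found
  ... | no none   = contradiction (≤-trans 3≤ (≤-trans (unique-⊆⇒length-≤ u sub) (length-thirds o o′)))
                                  λ { (s≤s (s≤s ())) }
    where
    thirds = thirdCell o ++ thirdCell o′
    length-thirds : ∀ o o′ → length (thirdCell o ++ thirdCell o′) ≤ 2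
    length-thirds (inj₁ _) (inj₁ _) = z≤n
    length-thirds (inj₁ _) (inj₂ _) = s≤s z≤n
    length-thirds (inj₂ _) (inj₁ _) = s≤s z≤n
    length-thirds (inj₂ _) (inj₂ _) = s≤s (s≤s z≤n)
    sub : ∀ {c} → c ∈ˡ cs → c ∈ˡ thirds
    sub {c} c∈ with DecMembership._∈?_ _≟ᶜ_ c thirds
    ... | yes c∈′ = c∈′
    ... | no c∉ = contradiction (All.¬Any⇒All¬ thirds c∉) (All.lookup (All.¬Any⇒All¬ cs none) c∈)

  -- One of the four distinct cells a, b of β, β′ is not among the at most two third cells; solve for it last.
  two-sums-sparse : ∀ β β′ o o′ → All (_# base β′) (base β) →
                    Sparse (N ^ 2) (λ A → Filling Ω A × SumIs β o A × SumIs β′ o′ A) (4 * T)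
  two-sums-sparse β β′ o o′ ((a≢a′ ∷ a≢b′ ∷ _) ∷ (b≢a′ ∷ b≢b′ ∷ _) ∷ _)
    with avoid-two o o′ {proj₂ (a β) ∷ proj₂ (b β) ∷ proj₂ (a β′) ∷ proj₂ (b β′) ∷ []}
      ((a≢b β ∷ a≢a′ ∷ a≢b′ ∷ []) ∷ (b≢a′ ∷ b≢b′ ∷ []) ∷ (a≢b β′ ∷ []) ∷ [] ∷ []) (s≤s (s≤s (s≤s z≤n)))
  ... | here c# = two-sums-sparse-pair o′ o (a β′) (b β′) (a β) (b β) proj₂ proj₁
            (a≢b β′) (a≢b β) a≢a′ a≢b′ (All.++⁻ʳ (thirdCell o) c#) (All.++⁻ˡ (thirdCell o) c#)
  ... | there (here c#) = two-sums-sparse-pair o′ o (a β′) (b β′) (b β) (a β)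
            proj₂ (λ {A} (h , _) → trans (+ᵥ-comm (value A (b β)) (value A (a β))) h)
            (a≢b β′) (a≢b β ∘ sym) b≢a′ b≢b′ (All.++⁻ʳ (thirdCell o) c#) (All.++⁻ˡ (thirdCell o) c#)
  ... | there (there (here c#)) = two-sums-sparse-pair o o′ (a β) (b β) (a β′) (b β′) proj₁ proj₂
            (a≢b β) (a≢b β′) (a≢a′ ∘ sym) (b≢a′ ∘ sym) (All.++⁻ˡ (thirdCell o) c#) (All.++⁻ʳ (thirdCell o) c#)
  ... | there (there (there (here c#))) = two-sums-sparse-pair o o′ (a β) (b β) (b β′) (a β′)
            proj₁ (λ {A} (_ , h) → trans (+ᵥ-comm (value A (b β′)) (value A (a β′))) h)
            (a≢b β) (a≢b β′ ∘ sym) (a≢b′ ∘ sym) (b≢b′ ∘ sym) (All.++⁻ˡ (thirdCell o) c#) (All.++⁻ʳ (thirdCell o) c#)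

  sum-from-0 : ∀ A (p q : Code {B = B}) {x} → x ≡ value A p +ᵥ value A q → x ≡ (0ᵥ +ᵥ value A p) +ᵥ value A q
  sum-from-0 A p q eq = trans eq (cong (_+ᵥ value A q) (sym (+ᵥ-identityˡ (value A p))))

  -- The last component takes an arbitrary remaining system `es`, so that the equations of one face
  -- can be stacked on those of another.
  ClosingSystem : (Code {B = B} → Code {B = B}) → Base → Code {B = B} → Set
  ClosingSystem g β u = ∃₂ λ e e′ →
    All Small (e ∷ e′ ∷ []) ×
    (∀ {A} → Closes g β u A → All (Holds A) (e ∷ e′ ∷ [])) ×
    (∀ {c} → c ∈ˡ cellsOf (e ∷ e′ ∷ []) → c ∈ˡ proj₂ u ∷ proj₂ (g u) ∷ base β) ×
    (∀ {es} → Triangular es → All (_# cellsOf es) (proj₂ u ∷ proj₂ (g u) ∷ base β) → Triangular (e ∷ e′ ∷ es))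

  -- If g u lies in the cell of u, eliminating u leaves an equation between the four base cells,
  -- which has a pivot by nondegeneracy.
  closingSystem : ∀ g β u → proj₂ u # base β → proj₂ (g u) # base β → ClosingSystem g β u
  closingSystem g β u (ua ∷ ub ∷ ua′ ∷ ub′ ∷ []) (ga ∷ gb ∷ ga′ ∷ gb′ ∷ []) with proj₂ (g u) ≟ᶜ proj₂ u
  -- Here `g u` and `u` themselves are the pivots, whatever coincidences there are among the base
  -- cells.
  ... | no gu≢u = equation (g u) (a′ β ∷ b′ β ∷ []) 0ᵥ , equation u (a β ∷ b β ∷ []) 0ᵥ
      , s≤s (s≤s z≤n) ∷ s≤s (s≤s z≤n) ∷ []
      , (λ {A} (h , h′) → sum-from-0 A (a′ β) (b′ β) (sym h′) ∷ sum-from-0 A (a β) (b β) (sym h) ∷ [])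
      , (λ { (here refl) → there (here refl)
           ; (there (here refl)) → there (there (there (there (here refl))))
           ; (there (there (here refl))) → there (there (there (there (there (here refl)))))
           ; (there (there (there (here refl)))) → here refl
           ; (there (there (there (there (here refl))))) → there (there (here refl))
           ; (there (there (there (there (there (here refl)))))) → there (there (there (here refl))) })
      , λ { tri (u#es ∷ gu#es ∷ _) → (ga′ ∷ gb′ ∷ gu≢u ∷ ga ∷ gb ∷ gu#es) , (ua ∷ ub ∷ u#es) , tri }
  ... | yes gu≡u with same-cell⇒turn {w = g u} {u} gu≡u
  ...   | s , gu≡ = result (nondegenerate β)
    where
    sums : ∀ A → Closes g β u A →
           value A (a β) +ᵥ value A (b β) ≡ value A (turn s (a′ β)) +ᵥ value A (turn s (b′ β))
    sums A (h , h′) = trans h (trans (sym (signed-signed s (value A u)))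
      (trans (cong (signed s) (trans (sym (value-turn A s u)) (trans (cong (value A) (sym gu≡)) (sym h′))))
      (trans (signed-+ᵥ s (value A (a′ β)) (value A (b′ β)))
        (sym (cong₂ _+ᵥ_ (value-turn A s (a′ β)) (value-turn A s (b′ β)))))))
    solve : ∀ A p q → value A p +ᵥ value A q ≡ value A (turn s (a′ β)) +ᵥ value A (turn s (b′ β)) →
            Holds A (equation p (turn s (a′ β) ∷ turn s (b′ β) ∷ neg q ∷ []) 0ᵥ)
    solve A p q eq = trans (x+y≡z⇒x≡z-y eq)
      (cong₂ _+ᵥ_ (sum-from-0 A (turn s (a′ β)) (turn s (b′ β)) refl) (sym (value-neg A q)))
    result : _ → ClosingSystem g β u
    result (inj₁ (aa′ , ab′)) = equation u (a β ∷ b β ∷ []) 0ᵥ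
      , equation (a β) (turn s (a′ β) ∷ turn s (b′ β) ∷ neg (b β) ∷ []) 0ᵥ
      , s≤s (s≤s z≤n) ∷ s≤s (s≤s (s≤s z≤n)) ∷ []
      , (λ {A} h → sum-from-0 A (a β) (b β) (sym (proj₁ h)) ∷ solve A (a β) (b β) (sums A h) ∷ [])
      , (λ { (here refl) → here refl
           ; (there (here refl)) → there (there (here refl))
           ; (there (there (here refl))) → there (there (there (here refl)))
           ; (there (there (there (here refl)))) → there (there (here refl))
           ; (there (there (there (there (here refl))))) → there (there (there (there (here refl))))
           ; (there (there (there (there (there (here refl)))))) → there (there (there (there (there (here refl)))))
           ; (there (there (there (there (there (there (here refl))))))) → there (there (there (here refl))) })
      , λ { tri (u#es ∷ _ ∷ a#es ∷ _) → (ua ∷ ub ∷ ua ∷ ua′ ∷ ub′ ∷ ub ∷ u#es) , (aa′ ∷ ab′ ∷ a≢b β ∷ a#es) , tri }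
    result (inj₂ (ba′ , bb′)) = equation u (a β ∷ b β ∷ []) 0ᵥ
      , equation (b β) (turn s (a′ β) ∷ turn s (b′ β) ∷ neg (a β) ∷ []) 0ᵥ
      , s≤s (s≤s z≤n) ∷ s≤s (s≤s (s≤s z≤n)) ∷ []
      , (λ {A} h → sum-from-0 A (a β) (b β) (sym (proj₁ h)) ∷ solve A (b β) (a β) (trans (+ᵥ-comm (value A (b β)) (value A (a β))) (sums A h)) ∷ [])
      , (λ { (here refl) → here refl
           ; (there (here refl)) → there (there (here refl))
           ; (there (there (here refl))) → there (there (there (here refl)))
           ; (there (there (there (here refl)))) → there (there (there (here refl)))
           ; (there (there (there (there (here refl))))) → there (there (there (there (here refl))))
           ; (there (there (there (there (there (here refl)))))) → there (there (there (there (there (here refl)))))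
           ; (there (there (there (there (there (there (here refl))))))) → there (there (here refl)) })
      , λ { tri (u#es ∷ _ ∷ _ ∷ b#es ∷ _) → (ua ∷ ub ∷ ub ∷ ua′ ∷ ub′ ∷ ua ∷ u#es) , (ba′ ∷ bb′ ∷ a≢b β ∘ sym ∷ b#es) , tri }

  #? : ∀ (c : Cell B) cs → Dec (c # cs)
  #? c cs = All.all? (λ d → ¬? (c ≟ᶜ d)) cs

  ¬#⇒∈ : ∀ {c : Cell B} {cs} → ¬ c # cs → c ∈ˡ cs
  ¬#⇒∈ {c} {cs} ¬c# with DecMembership._∈?_ _≟ᶜ_ c cs
  ... | yes c∈ = c∈
  ... | no c∉  = contradiction (All.¬Any⇒All¬ cs c∉) ¬c#

  sparse-cell∈ : ∀ (cs : List (Cell B)) → Sparse 1 (λ (u : Code {B = B}) → proj₂ u ∈ˡ cs) (2 * length cs)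
  sparse-cell∈ cs = sparse-≤ (≤-reflexive (length-cartesianProduct signs cs))
    (sparse-⊆ (λ {u} → ∈-cartesianProduct⁺ (∈-signs (proj₁ u))) (sparse-∈ (cartesianProduct signs cs)))

  length-allCodes : length (allCodes {B = B}) ≡ 2 * N
  length-allCodes = length-cartesianProduct signs (allCells {B = B})

  sparse-cancel-N : ∀ {M K} {P : PFArray v m n → Set} → Sparse (N * M) P (N * K) → Sparse M P K
  sparse-cancel-N {M} {K} S .bound {xs} u p = *-cancelˡ-≤ N {{ℕ.>-nonZero (≤-trans (s≤s z≤n) 32≤N)}}
    (≤-trans (≤-reflexive (sym (*-assoc N M (length xs)))) (S .bound u p))

  -- Summing over at most 2N codes costs one factor N.
  sparse-⋃-codes : ∀ {M K} {P : Code {B = B} → PFArray v m n → Set} us → length us ≤ 2 * N →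
    (∀ {u} → u ∈ˡ us → Sparse (N * M) (P u) K) → Sparse M (λ A → ∃ λ u → u ∈ˡ us × P u A) (2 * K)
  sparse-⋃-codes {M} {K} us le S = sparse-cancel-N (sparse-≤ (begin
    length us * K  ≤⟨ *-monoˡ-≤ K le ⟩
    2 * N * K      ≡⟨ cong (_* K) (*-comm 2 N) ⟩
    N * 2 * K      ≡⟨ *-assoc N 2 K ⟩
    N * (2 * K)    ∎) (sparse-⋃ us S))
    where open ≤-Reasoning

-- Two faces under a fixed action on the codes

triangleBound : ℕ → ℕ → ℕ
triangleBound D T =
  -- One summand for each case of `two-triangles-sparse`. The factors 4, 8, 16 before `T` are 2 to
  -- the number of equations, `D` counts exceptional thirds, each outer 2 comes from a sum over at
  -- most 2N codes, and the remaining 8 counts the codes that, themselves or through their images,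
  -- meet the cells of `u` and `g u`.
  D * (D * (4 * T)) + (2 * (D * (8 * T)) + (2 * (D * (8 * T)) + (2 * (8 * (8 * T)) + 2 * (2 * (16 * T)))))

module FixedSymmetry {v m n : ℕ} .{{_ : NonZero v}} (B : Cells m n) (Ω : Subset v)
                     (outcomes : Enumeration (Filling {B = B} Ω))
                     (32≤N : 32 ≤ length (allCells {B = B}))
                     (g : Code {B = B} → Code {B = B}) (g-injective : ∀ {u w} → g u ≡ g w → u ≡ w) where

  open Systems B Ω outcomes
  open Bases B Ω outcomes 32≤N
  open Base
  open Equation

  Avoids : List (Cell B) → Code {B = B} → Set
  Avoids cs u = proj₂ u # cs × proj₂ (g u) # cs

  avoids? : ∀ cs → Decidable (Avoids cs)
  avoids? cs u = #? (proj₂ u) cs ×-dec #? (proj₂ (g u)) cs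

  hitting : List (Cell B) → List (Code {B = B})
  hitting cs = filter (¬? ∘ avoids? cs) allCodes

  -- Every cell carries two codes. Since `g` is injective, the condition on `g u` excludes no more
  -- codes than the condition on `u`.
  length-hitting : ∀ cs → length (hitting cs) ≤ 2 * length cs + 2 * length cs
  length-hitting cs = sparse-filter (¬? ∘ avoids? cs)
    (sparse-⊆ hit (sparse-⊎ (sparse-cell∈ cs) (sparse-∘ g-injective (sparse-cell∈ cs)))) allCodes-unique
    where
    hit : ∀ {u} → ¬ Avoids cs u → proj₂ u ∈ˡ cs ⊎ proj₂ (g u) ∈ˡ cs
    hit {u} ¬av with #? (proj₂ u) cs
    ... | no ¬u# = inj₁ (¬#⇒∈ ¬u#)
    ... | yes u# = inj₂ (¬#⇒∈ λ gu# → ¬av (u# , gu#))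

  avoiding : List (Cell B) → List (Code {B = B}) → List (Code {B = B})
  avoiding cs = filter (avoids? cs)

  -- The third `o` may lie in any cell, even one of the closing system, so only the sum at `β′` is
  -- used there. Its pivot is whichever step of `β′` is not in the cell of `o`; it stays clear of
  -- the closing system because `u` and `g u` avoid `β′`.
  closing-sum-sparse : ∀ β β′ u o → All (_# base β) (base β′) → Avoids (base β) u → Avoids (base β′) u →
    Sparse (N ^ 3) (λ A → Filling Ω A × Closes g β u A × SumIs β′ o A) (8 * T)
  closing-sum-sparse β β′ u o (a#β ∷ b#β ∷ _) (u#β , gu#β) (ua ∷ ub ∷ _ , ga ∷ gb ∷ _)
    with closingSystem g β u u#β gu#β | avoid-one o (a≢b β′)
  ... | e , e′ , small , holds , sub , tri | inj₁ a#o =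
    system-sparse (sumEq (a β′) (b β′) o ∷ e ∷ e′ ∷ [])
      (triangular-sumEq (a β′) (b β′) o {e ∷ e′ ∷ []} a#o (a≢b β′) (#-⊆ sub ((ua ∘ sym) ∷ (ga ∘ sym) ∷ a#β))
        (tri {[]} tt (All.universal (λ _ → []) _)))
      (small-sumEq (a β′) (b β′) o ∷ small) (s≤s (s≤s (s≤s z≤n)))
      (λ {A} (h , h′) → holds-sumEq {A} (a β′) (b β′) o h′ ∷ holds h)
  ... | e , e′ , small , holds , sub , tri | inj₂ b#o =
    system-sparse (sumEq (b β′) (a β′) o ∷ e ∷ e′ ∷ [])
      (triangular-sumEq (b β′) (a β′) o {e ∷ e′ ∷ []} b#o (a≢b β′ ∘ sym) (#-⊆ sub ((ub ∘ sym) ∷ (gb ∘ sym) ∷ b#β))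
        (tri {[]} tt (All.universal (λ _ → []) _)))
      (small-sumEq (b β′) (a β′) o ∷ small) (s≤s (s≤s (s≤s z≤n)))
      (λ {A} (h , h′) → holds-sumEq {A} (b β′) (a β′) o (trans (+ᵥ-comm (value A (b β′)) (value A (a β′))) h′) ∷ holds h)

  -- The closing systems share no cells and can be stacked. Their four pivots pay for the sums over
  -- both `u` and `u′` and still leave two factors N.
  closing-closing-sparse : ∀ β β′ u u′ → All (_# base β) (base β′) →
    Avoids (base β) u → Avoids (base β′) u → Avoids (base β) u′ → Avoids (base β′) u′ →
    Avoids (proj₂ u ∷ proj₂ (g u) ∷ []) u′ →
    Sparse (N ^ 4) (λ A → Filling Ω A × Closes g β u A × Closes g β′ u′ A) (16 * T)
  closing-closing-sparse β β′ u u′ β′#β (u#β , gu#β) (u#β′ , gu#β′) (u′#β , gu′#β) (u′#β′ , gu′#β′) (u′# , gu′#)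
    with closingSystem g β u u#β gu#β | closingSystem g β′ u′ u′#β′ gu′#β′
  ... | e , e′ , small , holds , sub , tri | f , f′ , small′ , holds′ , _ , tri′ =
    system-sparse (f ∷ f′ ∷ e ∷ e′ ∷ []) (tri′ {e ∷ e′ ∷ []} (tri {[]} tt (All.universal (λ _ → []) _)) (All.map (#-⊆ sub) cross))
      (All.++⁺ small′ small) ≤-refl (λ (h , h′) → All.++⁺ (holds′ h′) (holds h))
    where
    cross : All (_# (proj₂ u ∷ proj₂ (g u) ∷ base β)) (proj₂ u′ ∷ proj₂ (g u′) ∷ base β′)
    cross = All.++⁺ u′# u′#β ∷ All.++⁺ gu′# gu′#β ∷ All.tabulate λ c∈ →
      (All.lookup u#β′ c∈ ∘ sym) ∷ (All.lookup gu#β′ c∈ ∘ sym) ∷ All.lookup β′#β c∈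

  module _ (js : List (Fin v)) where

    InTriangle : Base → PFArray v m n → Set
    InTriangle β A = (∃ λ j → j ∈ˡ js × SumIs β (inj₁ j) A) ⊎ (∃ λ u → Closes g β u A)

    -- The two bases together list eight cells, which by `length-hitting` spoil at most 16 + 16
    -- third codes; the other exceptional thirds are the elements of `js`.
    D : ℕ
    D = length js + 32

    -- A third code is generic if neither it nor its image meets a base cell. There are at most D thirds that
    -- are not generic, and each generic one is cut out by two equations instead of one.
    two-triangles-sparse : ∀ β β′ → All (_# base β′) (base β) →
      Sparse (N ^ 2) (λ A → Filling Ω A × InTriangle β A × InTriangle β′ A)
        (triangleBound D T)
    two-triangles-sparse β β′ β#β′ = sparse-⊆ cases
      (sparse-⊎ both-exceptional (sparse-⊎ (first-generic β β′ β′#β good⇒β good⇒β′)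
        (sparse-⊎ (first-generic β′ β β#β′ good⇒β′ good⇒β) (sparse-⊎ dependent independent))))
      where
      Sp = base β ++ base β′
      good bad : List (Code {B = B})
      good = avoiding Sp allCodes
      bad  = hitting Sp
      exceptional : List Third
      exceptional = map inj₁ js ++ map inj₂ bad

      length-exceptional : length exceptional ≤ D
      length-exceptional = ≤-trans (≤-reflexive (trans (length-++ (map inj₁ js))
          (cong₂ _+_ (length-map inj₁ js) (length-map inj₂ bad))))
        (+-monoʳ-≤ (length js) (length-hitting Sp))

      length-avoiding : ∀ us cs → length us ≤ 2 * N → length (avoiding cs us) ≤ 2 * N
      length-avoiding us cs = ≤-trans (length-filter (avoids? cs) us)

      length-good : length good ≤ 2 * N
      length-good = length-avoiding allCodes Sp (≤-reflexive length-allCodes)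

      good⇒β : ∀ {u} → u ∈ˡ good → Avoids (base β) u
      good⇒β u∈ = let u# , gu# = proj₂ (∈-filter⁻ (avoids? Sp) {xs = allCodes} u∈)
                  in All.++⁻ˡ (base β) u# , All.++⁻ˡ (base β) gu#

      good⇒β′ : ∀ {u} → u ∈ˡ good → Avoids (base β′) u
      good⇒β′ u∈ = let u# , gu# = proj₂ (∈-filter⁻ (avoids? Sp) {xs = allCodes} u∈)
                   in All.++⁻ʳ (base β) u# , All.++⁻ʳ (base β) gu#

      β′#β : All (_# base β) (base β′)
      β′#β = All.tabulate λ c∈ → All.tabulate λ d∈ c≡d → All.lookup (All.lookup β#β′ d∈) c∈ (sym c≡d)

      pair : Code {B = B} → List (Cell B)
      pair u = proj₂ u ∷ proj₂ (g u) ∷ []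

      BothExceptional Dependent Independent : PFArray v m n → Set
      BothExceptional A = ∃ λ o → o ∈ˡ exceptional × ∃ λ o′ → o′ ∈ˡ exceptional ×
        Filling Ω A × SumIs β o A × SumIs β′ o′ A
      Dependent A = ∃ λ u → u ∈ˡ good × ∃ λ u′ → u′ ∈ˡ hitting (pair u) ×
        Filling Ω A × Closes g β u A × SumIs β′ (inj₂ u′) A
      Independent A = ∃ λ u → u ∈ˡ good × ∃ λ u′ → u′ ∈ˡ avoiding (pair u) good ×
        Filling Ω A × Closes g β u A × Closes g β′ u′ A

      FirstGeneric : Base → Base → PFArray v m n → Set
      FirstGeneric γ γ′ A = ∃ λ u → u ∈ˡ good × ∃ λ o → o ∈ˡ exceptional ×
        Filling Ω A × Closes g γ u A × SumIs γ′ o A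

      both-exceptional : Sparse (N ^ 2) BothExceptional
        (D * (D * (4 * T)))
      both-exceptional = sparse-≤ (*-monoˡ-≤ (D * (4 * T)) length-exceptional)
        (sparse-⋃ exceptional λ {o} _ → sparse-≤ (*-monoˡ-≤ (4 * T) length-exceptional)
          (sparse-⋃ exceptional λ {o′} _ → two-sums-sparse β β′ o o′ β#β′))

      -- Only the generic third ranges over order N values, so of the three factors N from the
      -- system two remain.
      first-generic : ∀ γ γ′ → All (_# base γ) (base γ′) →
        (∀ {u} → u ∈ˡ good → Avoids (base γ) u) → (∀ {u} → u ∈ˡ good → Avoids (base γ′) u) →
        Sparse (N ^ 2) (FirstGeneric γ γ′) (2 * (D * (8 * T)))
      first-generic γ γ′ γ′#γ ⇒γ ⇒γ′ = sparse-⋃-codes good length-good λ {u} u∈ →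
        sparse-≤ (*-monoˡ-≤ (8 * T) length-exceptional)
          (sparse-⋃ exceptional λ {o} _ → closing-sum-sparse γ γ′ u o γ′#γ (⇒γ u∈) (⇒γ′ u∈))

      -- Once `u` is chosen, at most eight `u′` interfere with it. With so few, the sum at `β′`
      -- suffices and its image equation is dropped.
      dependent : Sparse (N ^ 2) Dependent (2 * (8 * (8 * T)))
      dependent = sparse-⋃-codes good length-good λ {u} u∈ →
        sparse-≤ (*-monoˡ-≤ (8 * T) (length-hitting (pair u)))
          (sparse-⋃ (hitting (pair u)) λ {u′} _ → closing-sum-sparse β β′ u (inj₂ u′) β′#β (good⇒β u∈) (good⇒β′ u∈))

      independent : Sparse (N ^ 2) Independent (2 * (2 * (16 * T)))
      independent = sparse-⋃-codes good length-good λ {u} u∈ →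
        sparse-⋃-codes (avoiding (pair u) good) (length-avoiding good (pair u) length-good) λ {u′} u′∈ →
          let u′∈good , u′# = ∈-filter⁻ (avoids? (pair u)) {xs = good} u′∈
          in closing-closing-sparse β β′ u u′ β′#β (good⇒β u∈) (good⇒β′ u∈) (good⇒β u′∈good) (good⇒β′ u′∈good) u′#

      classify : ∀ γ {A} → InTriangle γ A →
        (∃ λ o → o ∈ˡ exceptional × SumIs γ o A) ⊎ (∃ λ u → u ∈ˡ good × Closes g γ u A)
      classify γ (inj₁ (j , j∈ , s)) = inj₁ (inj₁ j , ∈-++⁺ˡ (∈-map⁺ inj₁ j∈) , s)
      classify γ (inj₂ (u , c)) with avoids? Sp u
      ... | yes av = inj₂ (u , ∈-filter⁺ (avoids? Sp) (∈-allCodes u) av , c)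
      ... | no ¬av = inj₁ (inj₂ u , ∈-++⁺ʳ (map inj₁ js) (∈-map⁺ inj₂ (∈-filter⁺ (¬? ∘ avoids? Sp) (∈-allCodes u) ¬av)) , proj₁ c)

      cases : ∀ {A} → Filling Ω A × InTriangle β A × InTriangle β′ A →
        BothExceptional A ⊎ FirstGeneric β β′ A ⊎ FirstGeneric β′ β A ⊎ Dependent A ⊎ Independent A
      cases (F , i , i′) = combine F (classify β i) (classify β′ i′)
        where
        combine : ∀ {A} → Filling Ω A →
          (∃ λ o → o ∈ˡ exceptional × SumIs β o A) ⊎ (∃ λ u → u ∈ˡ good × Closes g β u A) →
          (∃ λ o → o ∈ˡ exceptional × SumIs β′ o A) ⊎ (∃ λ u → u ∈ˡ good × Closes g β′ u A) →
          BothExceptional A ⊎ FirstGeneric β β′ A ⊎ FirstGeneric β′ β A ⊎ Dependent A ⊎ Independent A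
        combine F (inj₁ (o , o∈ , s)) (inj₁ (o′ , o′∈ , s′)) = inj₁ (o , o∈ , o′ , o′∈ , F , s , s′)
        combine F (inj₂ (u , u∈ , c)) (inj₁ (o′ , o′∈ , s′)) = inj₂ (inj₁ (u , u∈ , o′ , o′∈ , F , c , s′))
        combine F (inj₁ (o , o∈ , s)) (inj₂ (u′ , u′∈ , c′)) = inj₂ (inj₂ (inj₁ (u′ , u′∈ , o , o∈ , F , c′ , s)))
        combine F (inj₂ (u , u∈ , c)) (inj₂ (u′ , u′∈ , c′)) = by-dependence (avoids? (pair u) u′)
          where
          by-dependence : Dec (Avoids (pair u) u′) → _
          by-dependence (yes av) = inj₂ (inj₂ (inj₂ (inj₂
            (u , u∈ , u′ , ∈-filter⁺ (avoids? (pair u)) u′∈ av , F , c , c′))))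
          by-dependence (no ¬av) = inj₂ (inj₂ (inj₂ (inj₁
            (u , u∈ , u′ , ∈-filter⁺ (¬? ∘ avoids? (pair u)) (∈-allCodes u′) ¬av , F , c , proj₁ c′))))

-- The rotation on codes

sign-cases : ∀ s s′ → s′ ≡ s ⊎ s′ ≡ opposite s
sign-cases Sign.+ Sign.+ = inj₁ refl
sign-cases Sign.+ Sign.- = inj₂ refl
sign-cases Sign.- Sign.+ = inj₂ refl
sign-cases Sign.- Sign.- = inj₁ refl

module _ {X : Set} where

  iterate-f : (f : X → X) → ∀ x i → iterate f (f x) i ≡ f (iterate f x i)
  iterate-f f x zero    = refl
  iterate-f f x (suc i) = iterate-f f (f x) i

  iterate-inverse : {f f⁻¹ : X → X} → (∀ x → f⁻¹ (f x) ≡ x) → ∀ x i → iterate f⁻¹ (iterate f x i) i ≡ x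
  iterate-inverse inv x zero    = refl
  iterate-inverse {f} {f⁻¹} inv x (suc i) = trans (iterate-f f⁻¹ (iterate f (f x) i) i)
    (trans (cong f⁻¹ (iterate-inverse inv (f x) i)) (inv x))

  iterate-homo : {f f′ g : X → X} → (∀ x → g (f x) ≡ f′ (g x)) → ∀ x i → g (iterate f x i) ≡ iterate f′ (g x) i
  iterate-homo homo x zero    = refl
  iterate-homo {f} {f′} homo x (suc i) = trans (iterate-homo homo (f x) i) (cong (λ y → iterate f′ y i) (homo x))

  iterate-+ : (f : X → X) → ∀ x i j → iterate f x (i + j) ≡ iterate f (iterate f x i) j
  iterate-+ f x zero    j = refl
  iterate-+ f x (suc i) j = iterate-+ f (f x) i j

  iterate-2-periodic : {f : X → X} {x : X} → f (f x) ≡ x → ∀ i → iterate f x i ∈ˡ x ∷ f x ∷ []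
  iterate-2-periodic         eq zero          = here refl
  iterate-2-periodic         eq (suc zero)    = there (here refl)
  iterate-2-periodic {f} {x} eq (suc (suc i)) =
    subst (λ y → iterate f y i ∈ˡ x ∷ f x ∷ []) (sym eq) (iterate-2-periodic eq i)

module Steps {m n : ℕ} {B : Cells m n} (αr αc : Cell B ↔ Cell B) where

  -- The rotation ρ₀ acts on codes by  + c ↦ - (αr c)  and  - c ↦ + (αc c).
  α α⁻¹ : Sign → Cell B → Cell B
  α   Sign.+ = to αc
  α   Sign.- = to αr
  α⁻¹ Sign.+ = from αc
  α⁻¹ Sign.- = from αr

  step step⁻¹ : Code {B = B} → Code {B = B}
  step   (s , c) = opposite s , α (opposite s) c
  step⁻¹ (s , c) = opposite s , α⁻¹ s c

  stepBy : Sign → Code {B = B} → Code {B = B}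
  stepBy Sign.+ = step
  stepBy Sign.- = step⁻¹

  α-α⁻¹ : ∀ s c → α s (α⁻¹ s c) ≡ c
  α-α⁻¹ Sign.+ c = strictlyInverseˡ αc c
  α-α⁻¹ Sign.- c = strictlyInverseˡ αr c

  α⁻¹-α : ∀ s c → α⁻¹ s (α s c) ≡ c
  α⁻¹-α Sign.+ c = strictlyInverseʳ αc c
  α⁻¹-α Sign.- c = strictlyInverseʳ αr c

  step-step⁻¹ : ∀ w → step (step⁻¹ w) ≡ w
  step-step⁻¹ (Sign.+ , c) = cong (Sign.+ ,_) (α-α⁻¹ Sign.+ c)
  step-step⁻¹ (Sign.- , c) = cong (Sign.- ,_) (α-α⁻¹ Sign.- c)

  step⁻¹-step : ∀ w → step⁻¹ (step w) ≡ w
  step⁻¹-step (Sign.+ , c) = cong (Sign.+ ,_) (α⁻¹-α Sign.- c)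
  step⁻¹-step (Sign.- , c) = cong (Sign.- ,_) (α⁻¹-α Sign.+ c)

  stepBy-injective : ∀ ε {w w′} → stepBy ε w ≡ stepBy ε w′ → w ≡ w′
  stepBy-injective Sign.+ {w} {w′} eq = trans (sym (step⁻¹-step w)) (trans (cong step⁻¹ eq) (step⁻¹-step w′))
  stepBy-injective Sign.- {w} {w′} eq = trans (sym (step-step⁻¹ w)) (trans (cong step eq) (step-step⁻¹ w′))

  neg-injective : ∀ {w w′ : Code {B = B}} → neg w ≡ neg w′ → w ≡ w′
  neg-injective {w} {w′} eq = trans (sym (neg-involutive w)) (trans (cong neg eq) (neg-involutive w′))

  -- A symmetry g ≠ id can map the triangle at w to itself only if it is reversing and g w = flip w.
  flip : Code {B = B} → Code {B = B}
  flip w = neg (step (neg w))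

  flip-injective : ∀ {w w′} → flip w ≡ flip w′ → w ≡ w′
  flip-injective = neg-injective ∘ stepBy-injective Sign.+ ∘ neg-injective

  module _ (compatible : Compatible αr αc) where

    infix 4 _⟶*_
    _⟶*_ : Code {B = B} → Code {B = B} → Set
    w ⟶* w′ = ∃ λ i → iterate step w i ≡ w′

    ⟶*-trans : ∀ {w w′ w″} → w ⟶* w′ → w′ ⟶* w″ → w ⟶* w″
    ⟶*-trans {w} (i , refl) (j , eq) = i + j , trans (iterate-+ step w i j) eq

    -- Two steps act on the negative codes as the composition of the orderings, which compatibility
    -- makes a single cycle; every positive code is one step from a negative one. Hence a map that
    -- commutes with the steps, or reverses them, is determined by one value.
    step-transitive : ∀ w w′ → w ⟶* w′
    step-transitive w (Sign.- , d) = toNegative w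
      where
      double : ∀ i c → iterate (to αr ∘ to αc) c i ≡ d → (Sign.- , c) ⟶* (Sign.- , d)
      double zero    c eq = 0 , cong (Sign.- ,_) eq
      double (suc i) c eq = ⟶*-trans (2 , refl) (double i (to αr (to αc c)) eq)
      toNegative : ∀ w → w ⟶* (Sign.- , d)
      toNegative (Sign.- , c) = let i , eq = compatible c d in double i c eq
      toNegative (Sign.+ , c) = ⟶*-trans (1 , refl) (toNegative (Sign.- , to αr c))
    step-transitive w (Sign.+ , d) =
      ⟶*-trans (step-transitive w (Sign.- , from αc d)) (1 , cong (Sign.+ ,_) (strictlyInverseˡ αc d))

  module Geometry (row-ordering : IsRowOrdering αr) (column-ordering : IsColumnOrdering αc)
                  (rows : ∀ i → 3 ≤ ∣ lookup B i ∣) (columns : ∀ j → 3 ≤ ∣ column B j ∣) where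

    open Cell

    -- If two moves returned to `c`, the cycle of its row or column would have at most two cells,
    -- whereas the line has at least three.
    α-α≢ : ∀ s c → α s (α s c) ≢ c
    α-α≢ Sign.+ c eq = <⇒≱ (columns (col c)) (≤-trans (≤-reflexive (sym (length-columnCells {B = B} (col c))))
      (unique-⊆⇒length-≤ (columnCells-unique (col c)) λ {d} d∈ →
        let i , eqᵢ = proj₂ column-ordering c d (sym (columnCells-col d∈))
        in subst (_∈ˡ _) eqᵢ (iterate-2-periodic {f = to αc} eq i)))
    α-α≢ Sign.- c eq = <⇒≱ (rows (row c)) (≤-trans (≤-reflexive (sym (length-rowCells {B = B} (row c))))
      (unique-⊆⇒length-≤ (rowCells-unique (row c)) λ {d} d∈ →
        let i , eqᵢ = proj₂ row-ordering c d (sym (rowCells-row d∈))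
        in subst (_∈ˡ _) eqᵢ (iterate-2-periodic {f = to αr} eq i)))

    α≢ : ∀ s c → α s c ≢ c
    α≢ s c eq = α-α≢ s c (trans (cong (α s) eq) eq)

    -- One move stays in the column, the other in the row. If they cancelled, the intermediate cell
    -- would share both with `c`, hence be `c`.
    α-opposite-α≢ : ∀ s c → α (opposite s) (α s c) ≢ c
    α-opposite-α≢ Sign.+ c eq = α≢ Sign.+ c
      (cell-≡ (trans (sym (proj₁ row-ordering (to αc c))) (cong row eq)) (proj₁ column-ordering c))
    α-opposite-α≢ Sign.- c eq = α≢ Sign.- c
      (cell-≡ (proj₁ row-ordering c) (trans (sym (proj₁ column-ordering (to αr c))) (cong col eq)))

    α≢α-opposite : ∀ s c → α s c ≢ α (opposite s) c
    α≢α-opposite Sign.+ c eq = α≢ Sign.+ c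
      (cell-≡ (trans (cong row eq) (proj₁ row-ordering c)) (proj₁ column-ordering c))
    α≢α-opposite Sign.- c eq = α≢ Sign.- c
      (cell-≡ (proj₁ row-ordering c) (trans (cong col eq) (proj₁ column-ordering c)))

    α-α-any≢ : ∀ s s′ c → α s′ (α s c) ≢ c
    α-α-any≢ s s′ c with sign-cases s s′
    ... | inj₁ refl = α-α≢ s c
    ... | inj₂ refl = α-opposite-α≢ s c

    next-cell : ∀ w → proj₂ (step (neg w)) ≡ α (proj₁ w) (proj₂ w)
    next-cell (s , c) = cong (λ s′ → α s′ c) (opposite-involutive s)

    -- The two ways in which the image of the pair of steps at `w` can occupy the same two cells.
    -- They are all that obstructs `nondegenerate` in a `Base`.
    Aligned Crossed : Sign → Code {B = B} → Code {B = B} → Set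
    Aligned ε w w′ = proj₂ w ≡ proj₂ w′ × proj₂ (step (neg w)) ≡ proj₂ (stepBy ε (neg w′))
    Crossed ε w w′ = proj₂ w ≡ proj₂ (stepBy ε (neg w′)) × proj₂ (step (neg w)) ≡ proj₂ w′

    ¬aligned : ∀ ε w w′ → (ε ≡ Sign.+ → w′ ≢ w) → ¬ Aligned ε w w′
    ¬aligned Sign.+ w@(s , c) w′@(s′ , .c) moved (refl , eq)
      with sign-cases s s′ | trans (sym (next-cell w)) (trans eq (next-cell w′))
    ... | inj₁ refl | _   = moved refl refl
    ... | inj₂ refl | eq′ = α≢α-opposite s c eq′
    ¬aligned Sign.- w@(s , c) (s′ , .c) moved (refl , eq) = α-α-any≢ s (opposite s′) c
      (trans (cong (α (opposite s′)) (trans (sym (next-cell w)) eq)) (α-α⁻¹ (opposite s′) c))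

    ¬crossed : ∀ ε w w′ → (ε ≡ Sign.- → w′ ≢ flip w) → ¬ Crossed ε w w′
    ¬crossed Sign.+ w@(s , c) w′@(s′ , d) moved (eq , eq′) = α-α-any≢ s s′ c
      (trans (cong (α s′) (trans (sym (next-cell w)) eq′)) (trans (sym (next-cell w′)) (sym eq)))
    ¬crossed Sign.- w@(s , c) w′@(s′ , .(α (opposite (opposite s)) c)) moved (eq , refl) with sign-cases s s′
    ... | inj₁ refl = α≢α-opposite s c (trans (sym (next-cell w))
                        (trans (sym (α-α⁻¹ (opposite s) _)) (cong (α (opposite s)) (sym eq))))
    -- The surviving case: the opposite sign in the next cell of `w` is exactly `flip w`.
    ... | inj₂ refl = moved refl (cong (_, α (opposite (opposite s)) c) (sym (cong opposite (opposite-involutive s))))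

    flip-flip≢ : ∀ w → flip (flip w) ≢ w
    flip-flip≢ w@(s , c) eq = α-opposite-α≢ s c (trans
      (trans (cong (α (opposite s)) (sym (next-cell w)))
        (trans (cong (λ s′ → α (opposite s′) (proj₂ (step (neg w)))) (sym (opposite-involutive s))) (sym (next-cell (flip w)))))
      (cong proj₂ eq))

    record Symmetric (ε : Sign) (g : Code {B = B} → Code {B = B}) : Set where
      field
        homo      : ∀ w → g (step w) ≡ stepBy ε (g w)
        injective : ∀ {w w′} → g w ≡ g w′ → w ≡ w′
        moves     : ε ≡ Sign.+ → ∀ w → g w ≢ w

      Nondegenerate : Code {B = B} → Set
      Nondegenerate w = ε ≡ Sign.- → g w ≢ flip w

      -- A reversing `g` is a reflection of the cycle of `step`. If it sends `w` to `flip w`, it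
      -- sends `flip w` back to `w`, which differs from `flip (flip w)`.
      nondegenerate-flip : Compatible αr αc → ∀ w → Nondegenerate w ⊎ Nondegenerate (flip w)
      nondegenerate-flip compatible w with ε ≟ˢ Sign.-
      ... | no ε≢- = inj₁ λ ε≡- → contradiction ε≡- ε≢-
      ... | yes refl with g w ≟ʷ flip w
      ...   | no gw≢  = inj₁ λ _ → gw≢
      ...   | yes gw≡ = inj₂ λ _ gfw≡ → flip-flip≢ w (trans (sym gfw≡) g-flip)
        where
        g-flip : g (flip w) ≡ w
        g-flip with step-transitive compatible w (flip w)
        ... | i , eq = trans (cong g (sym eq)) (trans (iterate-homo homo w i)
          (trans (cong (λ x → iterate step⁻¹ x i) (trans gw≡ (sym eq))) (iterate-inverse step⁻¹-step w i)))

    -- What a symmetry with action g on the codes says about the triangles at 0.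
    Triangles : {v : ℕ} .{{_ : NonZero v}} → List (Fin v) → Sign → (Code {B = B} → Code {B = B}) → PFArray v m n → Set
    Triangles js ε g A = ∀ w →
        (∃ λ j → j ∈ˡ js × value A w +ᵥ value A (step (neg w)) ≡ j)
      ⊎ (∃ λ u → value A w +ᵥ value A (step (neg w)) ≡ value A u
               × value A (g w) +ᵥ value A (stepBy ε (neg (g w))) ≡ value A (g u))

-- Choice of two faces and the sum over all symmetries

module Asymmetry {v m n : ℕ} .{{_ : NonZero v}} (B : Cells m n) (Ω : Subset v)
                 (outcomes : Enumeration (Filling {B = B} Ω))
                 (33≤N : 33 ≤ length (allCells {B = B}))
                 (αr αc : Cell B ↔ Cell B) (compatible : Compatible αr αc)
                 (row-ordering : IsRowOrdering αr) (column-ordering : IsColumnOrdering αc)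
                 (rows : ∀ i → 3 ≤ ∣ lookup B i ∣) (columns : ∀ j → 3 ≤ ∣ column B j ∣)
                 (js : List (Fin v)) (w₀ : Code {B = B}) where

  32≤N : 32 ≤ length (allCells {B = B})
  32≤N = ≤-trans (n≤1+n 32) 33≤N

  open Systems B Ω outcomes using (N; T)
  open Bases B Ω outcomes 32≤N
  open Steps αr αc
  open Geometry row-ordering column-ordering rows columns

  limit : ℕ
  limit = triangleBound (length js + 32) T

  SymmetricAt : Sign → Code {B = B} → PFArray v m n → Set
  SymmetricAt ε w₁ A = ∃ λ g → Symmetric ε g × g w₀ ≡ w₁ × Triangles js ε g A

  module _ {ε : Sign} {g : Code {B = B} → Code {B = B}} (symmetric : Symmetric ε g) where

    open Symmetric symmetric
    open FixedSymmetry B Ω outcomes 32≤N g injective using (two-triangles-sparse)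

    triangle : Code {B = B} → List (Cell B)
    triangle w = proj₂ w ∷ proj₂ (step (neg w)) ∷ proj₂ (g w) ∷ proj₂ (stepBy ε (neg (g w))) ∷ []

    baseAt : ∀ w → Nondegenerate w → Base
    baseAt w nondeg = record
      { a = w ; b = step (neg w) ; a′ = g w ; b′ = stepBy ε (neg (g w))
      ; a≢b = a≢b
      ; nondegenerate = nd
      }
      where
      a≢b : proj₂ w ≢ proj₂ (step (neg w))
      a≢b eq = α≢ (proj₁ w) (proj₂ w) (trans (sym (next-cell w)) (sym eq))
      nd : _
      nd with proj₂ w ≟ᶜ proj₂ (g w) | proj₂ w ≟ᶜ proj₂ (stepBy ε (neg (g w)))
      ... | no a≢a′   | no a≢b′   = inj₁ (a≢a′ , a≢b′)
      ... | yes a≡a′  | _         = inj₂ ((λ b≡a′ → a≢b (trans a≡a′ (sym b≡a′)))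
                                         , λ b≡b′ → ¬aligned ε w (g w) (λ ε≡ → moves ε≡ w) (a≡a′ , b≡b′))
      ... | no _      | yes a≡b′  = inj₂ ((λ b≡a′ → ¬crossed ε w (g w) nondeg (a≡b′ , b≡a′))
                                         , λ b≡b′ → a≢b (trans a≡b′ (sym b≡b′)))

    Apart : List (Cell B) → Code {B = B} → Set
    Apart cs w = All (_# cs) (triangle w)

    -- Each of the four codes of the triangle is an injective function of `w`, so each meets `cs`
    -- for at most two values of `w` per cell.
    sparse-¬apart : ∀ cs → Sparse 1 (λ w → ¬ Apart cs w) (4 * (2 * length cs))
    sparse-¬apart cs = sparse-⊆ meets (sparse-⊎ (sparse-cell∈ cs)
        (sparse-⊎ (sparse-∘ (neg-injective ∘ stepBy-injective Sign.+) (sparse-cell∈ cs))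
        (sparse-⊎ (sparse-∘ injective (sparse-cell∈ cs))
                  (sparse-≤ (m≤m+n _ 0) (sparse-∘ (injective ∘ neg-injective ∘ stepBy-injective ε) (sparse-cell∈ cs))))))
      where
      meets : ∀ {w} → ¬ Apart cs w → proj₂ w ∈ˡ cs ⊎ proj₂ (step (neg w)) ∈ˡ cs ⊎
                                     proj₂ (g w) ∈ˡ cs ⊎ proj₂ (stepBy ε (neg (g w))) ∈ˡ cs
      meets {w} ¬ap with #? (proj₂ w) cs | #? (proj₂ (step (neg w))) cs | #? (proj₂ (g w)) cs
                       | #? (proj₂ (stepBy ε (neg (g w)))) cs
      ... | no p  | _     | _     | _     = inj₁ (¬#⇒∈ p)
      ... | yes _ | no p  | _     | _     = inj₂ (inj₁ (¬#⇒∈ p))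
      ... | yes _ | yes _ | no p  | _     = inj₂ (inj₂ (inj₁ (¬#⇒∈ p)))
      ... | yes _ | yes _ | yes _ | no p  = inj₂ (inj₂ (inj₂ (¬#⇒∈ p)))
      ... | yes p | yes q | yes r | yes s = contradiction (p ∷ q ∷ r ∷ s ∷ []) ¬ap

    apart? : ∀ cs → Decidable (Apart cs)
    apart? cs w = All.all? (λ c → #? c cs) (triangle w)

    -- Both `w` and `flip w` are kept away from `cs`, because only one of the two is known to be
    -- nondegenerate. With four cells, at most 32 + 32 of the 2N codes are lost, hence the bound 33
    -- on N.
    exists-apart : ∀ cs → length cs ≤ 4 → ∃ λ w → Apart cs w × Apart cs (flip w)
    exists-apart cs ≤4 with sparse-∃¬ (λ w → ¬? (apart? cs w) ⊎-dec ¬? (apart? cs (flip w)))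
      (sparse-⊎ (sparse-¬apart cs) (sparse-∘ flip-injective (sparse-¬apart cs))) allCodes-unique many
      where
      many : 4 * (2 * length cs) + 4 * (2 * length cs) < length (allCodes {B = B})
      many = begin-strict
        4 * (2 * length cs) + 4 * (2 * length cs) ≤⟨ +-mono-≤ (*-monoʳ-≤ 4 (*-monoʳ-≤ 2 ≤4)) (*-monoʳ-≤ 4 (*-monoʳ-≤ 2 ≤4)) ⟩
        2 * 32                                    <⟨ *-monoʳ-< 2 33≤N ⟩
        2 * N                                     ≡⟨ length-allCodes ⟨
        length (allCodes {B = B})                 ∎
        where open ≤-Reasoning
    ... | w , ¬¬ap with apart? cs w | apart? cs (flip w)
    ...   | yes p | yes q = w , p , q
    ...   | no ¬p | _     = contradiction (inj₁ ¬p) ¬¬ap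
    ...   | _     | no ¬q = contradiction (inj₂ ¬q) ¬¬ap

    TwoBases : Set
    TwoBases = ∃₂ λ w w′ → Nondegenerate w × Nondegenerate w′ × All (_# triangle w′) (triangle w)

    second-base : ∀ w → Nondegenerate w → (∃ λ w′ → Apart (triangle w) w′ × Apart (triangle w) (flip w′)) → TwoBases
    second-base w nd (w′ , ap , ap′) = Sum.[_,_]′
      (λ nd′ → w′ , w , nd′ , nd , ap) (λ nd′ → flip w′ , w , nd′ , nd , ap′) (nondegenerate-flip compatible w′)

    two-bases : TwoBases
    two-bases = Sum.[_,_]′ (λ nd → second-base w₀ nd (exists-apart (triangle w₀) ≤-refl))
      (λ nd → second-base (flip w₀) nd (exists-apart (triangle (flip w₀)) ≤-refl)) (nondegenerate-flip compatible w₀)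

    triangles-sparse : Sparse (N ^ 2) (λ A → Filling Ω A × Triangles js ε g A) limit
    triangles-sparse = from-bases two-bases
      where
      from-bases : TwoBases → Sparse (N ^ 2) (λ A → Filling Ω A × Triangles js ε g A) limit
      from-bases (w , w′ , nd , nd′ , disjoint) = sparse-⊆ (λ (F , tr) → F , tr w , tr w′)
        (two-triangles-sparse js (baseAt w nd) (baseAt w′ nd′) disjoint)

  -- Two symmetries with the same ε and g w₀ act in the same way on all codes.
  symmetricAt-sparse : ∀ ε w₁ → Sparse (N ^ 2) (λ A → Filling Ω A × SymmetricAt ε w₁ A) limit
  symmetricAt-sparse ε w₁ .bound {[]} _ _ = ≤-trans (≤-reflexive (*-zeroʳ (N ^ 2))) z≤n
  -- The `g` that is held fixed is the one of the first array in the list; all other arrays are then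
  -- shown to satisfy its equations.
  symmetricAt-sparse ε w₁ .bound {A ∷ As} u all@((_ , g , symmetric , g₀ , _) ∷ _) =
    triangles-sparse symmetric .bound u (All.map (λ {A′} (F , g′ , symmetric′ , g₀′ , tr) → F , transfer g′ {A′} symmetric′ g₀′ tr) all)
    where
    transfer : ∀ g′ {A} → Symmetric ε g′ → g′ w₀ ≡ w₁ → Triangles js ε g′ A → Triangles js ε g A
    transfer g′ {A} symmetric′ g₀′ tr w = Sum.map₂ (Product.map₂ λ {u} → Product.map₂
      (subst₂ (λ x y → value A x +ᵥ value A (stepBy ε (neg x)) ≡ value A y) (agree w) (agree u))) (tr w)
      where
      agree : ∀ w → g′ w ≡ g w
      agree w with step-transitive compatible w₀ w
      ... | i , refl = trans (iterate-homo (Symmetric.homo symmetric′) w₀ i)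
        (trans (cong (λ x → iterate (stepBy ε) x i) (trans g₀′ (sym g₀)))
          (sym (iterate-homo (Symmetric.homo symmetric) w₀ i)))

  -- A symmetry is determined by its orientation and by the image of `w₀`: two choices times 2N,
  -- which uses up one of the two factors N.
  symmetric-sparse : Sparse N (λ A → Filling Ω A × ∃₂ λ ε g → Symmetric ε g × Triangles js ε g A) (2 * (2 * limit))
  symmetric-sparse = sparse-⊆
    (λ (F , ε , g , s , tr) → ε , ∈-signs ε , g w₀ , ∈-allCodes (g w₀) , F , g , s , refl , tr)
    (sparse-⋃ signs λ {ε} _ → sparse-⋃-codes allCodes (≤-reflexive length-allCodes) λ {w₁} _ →
      sparse-cong (cong (N *_) (*-identityʳ N)) (symmetricAt-sparse ε w₁))
    where
    sparse-cong : ∀ {M M′ K} {P : PFArray v m n → Set} → M ≡ M′ → Sparse M P K → Sparse M′ P K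
    sparse-cong refl S = S

-- Symmetries of the embedding

module _ {v : ℕ} .{{_ : NonZero v}} where

  [x+y]-y≡x : (x y : Fin v) → (x +ᵥ y) -ᵥ y ≡ x
  [x+y]-y≡x x y = trans (cong (_-ᵥ y) (+ᵥ-comm x y)) ([x+y]-x≡y y x)

module Labelling {v : ℕ} (t : ℕ) .{{_ : NonZero v}} .{{_ : NonZero t}} {m n : ℕ} {B : Cells m n} {Ω : Subset v}
                 (covers : ±CoversOnce t {I = ∃ λ (x : Fin v) → x ∈ Ω} proj₁)
                 {A : PFArray v m n} (F : Filling {B = B} Ω A) where

  open Filling F

  value∉J : ∀ w → ¬ InJ t (value A w)
  value∉J (s , c) = proj₂ covers s (at A c , at∈Ω c)

  decode : (z : Fin v) → ¬ InJ t z → ∃ λ w → value A w ≡ z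
  decode z z∉J with proj₁ covers z z∉J
  ... | (s , x , x∈) , eq , _ = let c , eq′ = onto x∈ in (s , c) , trans (cong (signed s) eq′) eq

  value-injective : ∀ {w w′} → value A w ≡ value A w′ → w ≡ w′
  value-injective {w@(s , c)} {w′@(s′ , c′)} eq with proj₁ covers (value A w) (value∉J w)
  ... | _ , _ , unique with trans (sym (unique {s , at A c , at∈Ω c} refl)) (unique {s′ , at A c′ , at∈Ω c′} (sym eq))
  ...   | eq′ = cong₂ _,_ (cong proj₁ eq′) (injective (cong (proj₁ ∘ proj₂) eq′))

module Symmetries {v : ℕ} (t : ℕ) .{{_ : NonZero v}} .{{_ : NonZero t}} {m n : ℕ} {B : Cells m n}
                  (αr αc : Cell B ↔ Cell B) where

  open Steps αr αc

  -- Compatibility with the rotation, read off on codes: if the edge at `x` with code `w` goes to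
  -- the edge at `f x` with code `w′`, the next edge goes to the next or the previous one. Adjacency
  -- proofs do not occur, and the condition can be checked finitely.
  Rotates : Sign → PFArray v m n → (Fin v → Fin v) → Set
  Rotates ε A f = ∀ x w w′ → f (x +ᵥ value A w) ≡ f x +ᵥ value A w′ →
                  f (x +ᵥ value A (step w)) ≡ f x +ᵥ value A (stepBy ε w′)

  record IsSymmetry (A : PFArray v m n) (f f⁻¹ : Fin v → Fin v) : Set where
    field
      f-f⁻¹          : ∀ x → f (f⁻¹ x) ≡ x
      f⁻¹-f          : ∀ x → f⁻¹ (f x) ≡ x
      adjacency      : ∀ x y → adjK v t (f x) (f y) ≡ adjK v t x y
      rotates        : Rotates Sign.+ A f ⊎ Rotates Sign.- A f
      nontranslation : ¬ ∃ λ g → ∀ x → f x ≡ x +ᵥ g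

  module _ (compatible : Compatible αr αc) (row-ordering : IsRowOrdering αr) (column-ordering : IsColumnOrdering αc)
           (rows : ∀ i → 3 ≤ ∣ lookup B i ∣) (columns : ∀ j → 3 ≤ ∣ column B j ∣)
           {Ω : Subset v} (covers : ±CoversOnce t {I = ∃ λ (x : Fin v) → x ∈ Ω} proj₁)
           {A : PFArray v m n} (F : Filling {B = B} Ω A) (w₀ : Code {B = B})
           {js : List (Fin v)} (J⊆js : ∀ {z : Fin v} → InJ t z → z ∈ˡ js) where

    open Geometry row-ordering column-ordering rows columns
    open Labelling t covers F

    module _ {f f⁻¹ : Fin v → Fin v} (symmetry : IsSymmetry A f f⁻¹) where

      open IsSymmetry symmetry

      -- Adjacency is preserved, so the difference of the two images lies outside `J` and is
      -- therefore a signed entry. Subtracting `f x` takes the place of normalising `f`.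
      transport : ∀ x w → ∃ λ w′ → f (x +ᵥ value A w) ≡ f x +ᵥ value A w′
      transport x w = let w′ , eq = decode (f (x +ᵥ value A w) -ᵥ f x) ∉J in
        w′ , trans (sym (x+[y-x]≡y (f x) (f (x +ᵥ value A w)))) (cong (f x +ᵥ_) (sym eq))
        where
        ∉J : ¬ InJ t (f (x +ᵥ value A w) -ᵥ f x)
        ∉J = adjK⇒∉J (f x) (f (x +ᵥ value A w)) (subst Bool.T (sym (adjacency x (x +ᵥ value A w)))
          (∉J⇒adjK x (x +ᵥ value A w) (value∉J w ∘ subst (InJ t) ([x+y]-x≡y x (value A w)))))

      g : Code {B = B} → Code {B = B}
      g w = proj₁ (transport 0ᵥ w)

      f-value : ∀ w → f (value A w) ≡ f 0ᵥ +ᵥ value A (g w)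
      f-value w = trans (cong f (sym (+ᵥ-identityˡ (value A w)))) (proj₂ (transport 0ᵥ w))

      +f0-cancel : ∀ {w w′} → f 0ᵥ +ᵥ value A w ≡ f 0ᵥ +ᵥ value A w′ → w ≡ w′
      +f0-cancel eq = value-injective (∙-cancelˡ ℤᵥ (f 0ᵥ) _ _ eq)

      g-injective : ∀ {w w′} → g w ≡ g w′ → w ≡ w′
      g-injective {w} {w′} eq = value-injective (trans (sym (f⁻¹-f (value A w)))
        (trans (cong f⁻¹ (trans (f-value w) (trans (cong (λ u → f 0ᵥ +ᵥ value A u) eq) (sym (f-value w′)))))
          (f⁻¹-f (value A w′))))

      -- The action of f on the edge from x = value w to 0.
      f-0 : ∀ w → f (value A w +ᵥ value A (neg w)) ≡ f (value A w) +ᵥ value A (neg (g w))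
      f-0 w = trans (cong f (trans (cong (value A w +ᵥ_) (value-neg A w)) (x-x≡0 (value A w)))) (sym (begin
        f (value A w) +ᵥ value A (neg (g w))              ≡⟨ cong₂ _+ᵥ_ (f-value w) (value-neg A (g w)) ⟩
        (f 0ᵥ +ᵥ value A (g w)) -ᵥ value A (g w)          ≡⟨ [x+y]-y≡x (f 0ᵥ) (value A (g w)) ⟩
        f 0ᵥ                                              ∎))
        where
        open ≡-Reasoning
        x-x≡0 : (x : Fin v) → x -ᵥ x ≡ 0ᵥ
        x-x≡0 x = trans (+ᵥ-comm x (-ᵥ x)) (+ᵥ-inverseˡ x)

      module _ {ε : Sign} (rotates : Rotates ε A f) where

        homo : ∀ w → g (step w) ≡ stepBy ε (g w)
        homo w = +f0-cancel (trans (sym (proj₂ (transport 0ᵥ (step w))))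
          (rotates 0ᵥ w (g w) (proj₂ (transport 0ᵥ w))))

        -- The rotation rule is applied at the vertex `value A w`, starting from its edge to 0. The
        -- edge after it ends at `value A u`, whose image is known both along this edge and along
        -- the edge from 0.
        closes : ∀ w u → value A u ≡ value A w +ᵥ value A (step (neg w)) →
                 value A (g w) +ᵥ value A (stepBy ε (neg (g w))) ≡ value A (g u)
        closes w u eq = ∙-cancelˡ ℤᵥ (f 0ᵥ) _ _ (begin
          f 0ᵥ +ᵥ (value A (g w) +ᵥ value A (stepBy ε (neg (g w)))) ≡⟨ +ᵥ-assoc (f 0ᵥ) (value A (g w)) _ ⟨
          (f 0ᵥ +ᵥ value A (g w)) +ᵥ value A (stepBy ε (neg (g w))) ≡⟨ cong (_+ᵥ value A (stepBy ε (neg (g w)))) (f-value w) ⟨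
          f (value A w) +ᵥ value A (stepBy ε (neg (g w)))           ≡⟨ rotates (value A w) (neg w) (neg (g w)) (f-0 w) ⟨
          f (value A w +ᵥ value A (step (neg w)))                   ≡⟨ cong f eq ⟨
          f (value A u)                                             ≡⟨ f-value u ⟩
          f 0ᵥ +ᵥ value A (g u)                                     ∎)
          where open ≡-Reasoning

        triangles : Triangles js ε g A
        triangles w = by-third (inJ? t (value A w +ᵥ value A (step (neg w))))
          where
          by-third : Dec (InJ t (value A w +ᵥ value A (step (neg w)))) → _
          by-third (yes ∈J) = inj₁ (_ , J⊆js ∈J , refl)
          by-third (no ∉J)  = let u , eq = decode _ ∉J in inj₂ (u , sym eq , closes w u eq)

      -- A fixed code makes `g` the identity, so `f` translates 0 and all its neighbours. An element
      -- of `J` is no neighbour of 0 but is one of `value A w`, around which `f` is the same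
      -- translation.
      moves : Rotates Sign.+ A f → ∀ w → g w ≢ w
      moves rotates w gw≡w = nontranslation (f 0ᵥ , λ x → trans (fixed x) (+ᵥ-comm (f 0ᵥ) x))
        where
        open ≡-Reasoning
        g≡id : ∀ u → g u ≡ u
        g≡id u = let i , eq = step-transitive compatible w u in
          trans (cong g (sym eq)) (trans (iterate-homo (homo {Sign.+} rotates) w i)
            (trans (cong (λ x → iterate step x i) gw≡w) eq))
        -- All neighbours of x = value w are translated by f 0, since its neighbour 0 is.
        near : ∀ u → f (value A w +ᵥ value A u) ≡ f (value A w) +ᵥ value A u
        near u = let i , eq = step-transitive compatible (neg w) u in
          subst (λ u → f (value A w +ᵥ value A u) ≡ f (value A w) +ᵥ value A u) eq
            (go i (neg w) (trans (f-0 w) (cong (λ u → f (value A w) +ᵥ value A (neg u)) (g≡id w))))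
          where
          go : ∀ i u → f (value A w +ᵥ value A u) ≡ f (value A w) +ᵥ value A u →
               f (value A w +ᵥ value A (iterate step u i)) ≡ f (value A w) +ᵥ value A (iterate step u i)
          go zero    u eq = eq
          go (suc i) u eq = go i (step u) (rotates (value A w) u u eq)
        fixed-value : ∀ u → f (value A u) ≡ f 0ᵥ +ᵥ value A u
        fixed-value u = trans (f-value u) (cong (λ u → f 0ᵥ +ᵥ value A u) (g≡id u))
        fixed : ∀ x → f x ≡ f 0ᵥ +ᵥ x
        fixed x = by-J (inJ? t x)
          where
          by-J : Dec (InJ t x) → f x ≡ f 0ᵥ +ᵥ x
          by-J (no x∉J) = let u , eq = decode x x∉J in subst (λ x → f x ≡ f 0ᵥ +ᵥ x) eq (fixed-value u)
          by-J (yes x∈J) = begin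
            f x                                      ≡⟨ cong f (x+[y-x]≡y (value A w) x) ⟨
            f (value A w +ᵥ (x -ᵥ value A w))        ≡⟨ cong (λ y → f (value A w +ᵥ y)) (proj₂ decoded) ⟨
            f (value A w +ᵥ value A u)               ≡⟨ near u ⟩
            f (value A w) +ᵥ value A u               ≡⟨ cong₂ _+ᵥ_ (fixed-value w) (proj₂ decoded) ⟩
            (f 0ᵥ +ᵥ value A w) +ᵥ (x -ᵥ value A w)  ≡⟨ +ᵥ-assoc (f 0ᵥ) (value A w) (x -ᵥ value A w) ⟩
            f 0ᵥ +ᵥ (value A w +ᵥ (x -ᵥ value A w))  ≡⟨ cong (f 0ᵥ +ᵥ_) (x+[y-x]≡y (value A w) x) ⟩
            f 0ᵥ +ᵥ x                                ∎
            where
            decoded : ∃ λ u → value A u ≡ x -ᵥ value A w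
            decoded = decode (x -ᵥ value A w) λ ∈J → value∉J w
              (subst (InJ t) (trans (cong (x +ᵥ_) (neg-sub (value A w) x)) (x+[y-x]≡y x (value A w)))
                (J-+ t x∈J (J-neg t ∈J)))
            u = proj₁ decoded

      symmetric-triangles : ∃₂ λ ε g → Symmetric ε g × Triangles js ε g A
      symmetric-triangles = by-orientation rotates
        where
        by-orientation : Rotates Sign.+ A f ⊎ Rotates Sign.- A f → _
        by-orientation (inj₁ r) = Sign.+ , g
          , record { homo = homo {Sign.+} r ; injective = g-injective ; moves = λ _ → moves r } , triangles {Sign.+} r
        by-orientation (inj₂ r) = Sign.- , g
          , record { homo = homo {Sign.-} r ; injective = g-injective ; moves = λ () } , triangles {Sign.-} r

-- Existence and finiteness of the fillings

lookup-injective : {X : Set} {xs : List X} → Unique xs → ∀ i j → List.lookup xs i ≡ List.lookup xs j → i ≡ j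
lookup-injective (_  ∷ _) zero        zero        _  = refl
lookup-injective (x∉ ∷ _) zero        (Fin.suc j) eq = contradiction eq (All.lookup x∉ (∈-lookup j))
lookup-injective (x∉ ∷ _) (Fin.suc i) zero        eq = contradiction (sym eq) (All.lookup x∉ (∈-lookup i))
lookup-injective (_  ∷ u) (Fin.suc i) (Fin.suc j) eq = cong Fin.suc (lookup-injective u i j eq)

module Matching {X Y : Set} {xs : List X} {ys : List Y} (complete : ∀ x → x ∈ˡ xs)
                (xs-unique : Unique xs) (ys-unique : Unique ys) (length≡ : length xs ≡ length ys) where

  position : X → Fin (length xs)
  position x = Any.index (complete x)

  lookup-position : ∀ x → x ≡ List.lookup xs (position x)
  lookup-position x = lookup-index (complete x)

  match : X → Y
  match x = List.lookup ys (Fin.cast length≡ (position x))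

  match-injective : ∀ {x x′} → match x ≡ match x′ → x ≡ x′
  match-injective {x} {x′} eq = trans (lookup-position x)
    (trans (cong (List.lookup xs) (toℕ-injective (trans (sym (toℕ-cast length≡ (position x)))
      (trans (cong toℕ (lookup-injective ys-unique _ _ eq)) (toℕ-cast length≡ (position x′))))))
    (sym (lookup-position x′)))

  match-onto : ∀ {y} → y ∈ˡ ys → ∃ λ x → match x ≡ y
  match-onto {y} y∈ = x , trans
    (cong (List.lookup ys) (trans
      (cong (Fin.cast length≡) (lookup-injective xs-unique (position x) i (sym (lookup-position x))))
      (cast-involutive length≡ (sym length≡) (Any.index y∈))))
    (sym (lookup-index y∈))
    where
    i = Fin.cast (sym length≡) (Any.index y∈)
    x = List.lookup xs i

enumeration-map : {X : Set} {P Q : X → Set} → (∀ {x} → P x → Q x) → (∀ {x} → Q x → P x) →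
                  Enumeration P → Enumeration Q
enumeration-map P⇒Q Q⇒P e = record
  { elements = elements ; unique = unique ; sound = P⇒Q ∘ sound ; complete = complete ∘ Q⇒P }
  where open Enumeration e

module SubgroupJ {v : ℕ} (t : ℕ) .{{_ : NonZero v}} .{{_ : NonZero t}} (t∣v : t ∣ v) where

  open ≡-Reasoning

  private q = v ℕ./ t

  q*t≡v : q * t ≡ v
  q*t≡v = m/n*n≡m t∣v

  multiple : Fin t → Fin v
  multiple i = (q * toℕ i) mod v

  allJ : List (Fin v)
  allJ = map multiple (allFin t)

  length-allJ : length allJ ≡ t
  length-allJ = trans (length-map multiple (allFin t)) (length-tabulate {n = t} id)

  allJ-sound : ∀ {z : Fin v} → z ∈ˡ allJ → InJ t z
  allJ-sound z∈ with ∈-map⁻ multiple z∈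
  ... | i , _ , refl = J-multiple t (toℕ i)

  -- Since `q * t` is `v`, a multiple of `q` modulo `v` depends only on the other factor modulo `t`.
  allJ-complete : ∀ {z : Fin v} → InJ t z → z ∈ˡ allJ
  allJ-complete {z} (y , refl) = subst (_∈ˡ allJ) eq (∈-map⁺ multiple (∈-allFin (toℕ y mod t)))
    where
    eq : multiple (toℕ y mod t) ≡ (q * toℕ y) mod v
    eq = mod-cong {v} {q * toℕ (toℕ y mod t)} {q * toℕ y} (begin
      (q * toℕ (toℕ y mod t)) % v                  ≡⟨ cong (λ a → (q * a) % v) (toℕ-mod {t} (toℕ y)) ⟩
      (q * (toℕ y % t)) % v                        ≡⟨ [m+kn]%n≡m%n (q * (toℕ y % t)) (toℕ y ℕ./ t) v ⟨
      (q * (toℕ y % t) + toℕ y ℕ./ t * v) % v      ≡⟨ cong (_% v) (begin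
        q * (toℕ y % t) + toℕ y ℕ./ t * v          ≡⟨ cong (λ a → q * (toℕ y % t) + a) (trans (cong (λ a → toℕ y ℕ./ t * a) (sym q*t≡v)) (*-swap (toℕ y ℕ./ t) q t)) ⟩
        q * (toℕ y % t) + q * (toℕ y ℕ./ t * t)    ≡⟨ *-distribˡ-+ q (toℕ y % t) (toℕ y ℕ./ t * t) ⟨
        q * (toℕ y % t + toℕ y ℕ./ t * t)          ≡⟨ cong (q *_) (m≡m%n+[m/n]*n (toℕ y) t) ⟨
        q * toℕ y                                  ∎) ⟩
      (q * toℕ y) % v                              ∎)
      where
      *-swap : ∀ a b c → a * (b * c) ≡ b * (a * c)
      *-swap a b c = trans (sym (*-assoc a b c)) (trans (cong (_* c) (*-comm a b)) (*-assoc b a c))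

  multiple-injective : ∀ {i j} → multiple i ≡ multiple j → i ≡ j
  multiple-injective {i} {j} eq = toℕ-injective (*-cancelˡ-≡ (toℕ i) (toℕ j) q {{q≢0}} (begin
    q * toℕ i           ≡⟨ m<n⇒m%n≡m (small i) ⟨
    (q * toℕ i) % v     ≡⟨ toℕ-mod {v} (q * toℕ i) ⟨
    toℕ (multiple i)    ≡⟨ cong toℕ eq ⟩
    toℕ (multiple j)    ≡⟨ toℕ-mod {v} (q * toℕ j) ⟩
    (q * toℕ j) % v     ≡⟨ m<n⇒m%n≡m (small j) ⟩
    q * toℕ j           ∎))
    where
    q≢0 : NonZero q
    q≢0 = m*n≢0⇒m≢0 q {{subst NonZero (sym q*t≡v) it}}
    small : ∀ i → q * toℕ i < v
    small i = subst (q * toℕ i <_) q*t≡v (*-monoʳ-< q {{q≢0}} (toℕ<n i))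

  allJ-unique : Unique allJ
  allJ-unique = Unique.map⁺ multiple-injective (Unique.allFin⁺ t)

  -- The signed elements of `Ω` and the `t` elements of `J` list every residue once. This gives `Ω`
  -- as many elements as `B` has cells, so that fillings exist and the probability is defined.
  2∣Ω∣+t≡v : {Ω : Subset v} → ±CoversOnce t {I = ∃ λ (x : Fin v) → x ∈ Ω} proj₁ → 2 * ∣ Ω ∣ + t ≡ v
  2∣Ω∣+t≡v {Ω} covers = trans (sym length-all) (≤-antisym
    (≤-trans (unique-⊆⇒length-≤ all-unique (λ _ → ∈-allFin _)) (≤-reflexive (length-tabulate {n = v} id)))
    (≤-trans (≤-reflexive (sym (length-tabulate {n = v} id))) (unique-⊆⇒length-≤ (Unique.allFin⁺ v) (λ {z} _ → all-complete z))))
    where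
    signedΩ : List (Sign × ∃ (_∈ Ω))
    signedΩ = cartesianProduct signs (members Ω)
    val : Sign × ∃ (_∈ Ω) → Fin v
    val (s , x , _) = signed s x
    all : List (Fin v)
    all = map val signedΩ ++ allJ
    val-injective : ∀ {w w′} → val w ≡ val w′ → w ≡ w′
    val-injective {w} {w′} eq with proj₁ covers (val w) (proj₂ covers (proj₁ w) (proj₂ w))
    ... | _ , _ , unique = trans (sym (unique refl)) (unique (sym eq))
    all-unique : Unique all
    all-unique = Unique.++⁺ (Unique.map⁺ val-injective (Unique.cartesianProduct⁺ signs-unique (members-unique Ω)))
      allJ-unique disjoint
      where
      disjoint : ∀ {z} → ¬ (z ∈ˡ map val signedΩ × z ∈ˡ allJ)
      disjoint (z∈ , z∈J) with ∈-map⁻ val z∈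
      ... | (s , x) , _ , refl = proj₂ covers s x (allJ-sound z∈J)
    all-complete : ∀ z → z ∈ˡ all
    all-complete z with inJ? t z
    ... | yes z∈J = ∈-++⁺ʳ (map val signedΩ) (allJ-complete z∈J)
    ... | no z∉J with proj₁ covers z z∉J
    ...   | (s , x , x∈) , refl , _ = ∈-++⁺ˡ (∈-map⁺ val (∈-cartesianProduct⁺ (∈-signs s) (∈-members x∈)))
    length-all : length all ≡ 2 * ∣ Ω ∣ + t
    length-all = trans (length-++ (map val signedΩ)) (cong₂ _+_
      (trans (length-map val signedΩ) (trans (length-cartesianProduct signs (members Ω)) (cong (2 *_) (length-members Ω))))
      length-allJ)

module _ {v m n : ℕ} where

  allArrays : List (PFArray v m n)
  allArrays = allVecs (allVecs (nothing ∷ map just (allFin v)) n) m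

  ∈-allArrays : ∀ A → A ∈ˡ allArrays
  ∈-allArrays = ∈-allVecs (∈-allVecs λ { nothing → here refl ; (just x) → there (∈-map⁺ just (∈-allFin x)) })

  infix 4 _≟ᴬ_
  _≟ᴬ_ : DecidableEquality (PFArray v m n)
  _≟ᴬ_ = Vec.≡-dec (Vec.≡-dec (Maybe.≡-dec _≟_))

module _ {v m n : ℕ} .{{_ : NonZero v}} {B : Cells m n} {Ω : Subset v} where

  some-filling : length (allCells {B = B}) ≡ ∣ Ω ∣ → ∃ (Filling {B = B} Ω)
  some-filling eq = fill (proj₁ ∘ match) , record
    { skeleton  = skel-fill (proj₁ ∘ match)
    ; injective = λ {c} {d} at≡ → match-injective (∃-≡ (trans (sym (at-fill _ c)) (trans at≡ (at-fill _ d))))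
    ; at∈Ω      = λ c → subst (_∈ Ω) (sym (at-fill _ c)) (proj₂ (match c))
    ; onto      = λ x∈ → let c , eq′ = match-onto (∈-members x∈) in c , trans (at-fill _ c) (cong proj₁ eq′)
    }
    where
    open Matching (∈-allCells {B = B}) (allCells-unique {B = B}) (members-unique Ω) (trans eq (sym (length-members Ω)))
    ∃-≡ : {x y : ∃ (_∈ Ω)} → proj₁ x ≡ proj₁ y → x ≡ y
    ∃-≡ {x , p} {.x , q} refl = cong (x ,_) (∈-irrelevant p q)

  filling? : Decidable (Filling {B = B} Ω)
  filling? A = map′
    (λ (sk , inj , ∈Ω , onto) → record
      { skeleton = sk ; injective = λ {c} {d} → inj c d ; at∈Ω = ∈Ω ; onto = λ {x} → onto x })
    (λ F → let open Filling F in skeleton , (λ c d → injective) , at∈Ω , λ x → onto)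
    (Vec.≡-dec (Vec.≡-dec Bool._≟_) (skel A) B
      ×-dec ∀ᶜ (λ c → ∀ᶜ λ d → (at A c ≟ at A d) →-dec (c ≟ᶜ d))
      ×-dec ∀ᶜ (λ c → at A c ∈? Ω)
      ×-dec all? (λ x → (x ∈? Ω) →-dec ∃? allCells ∈-allCells (λ c → at A c ≟ x)))
    where
    ∀ᶜ : {P : Cell B → Set} → Decidable P → Dec (∀ c → P c)
    ∀ᶜ = ∀? allCells ∈-allCells

-- Automorphisms of the Archdeacon embedding

module _ {v : ℕ} (t h k : ℕ) .{{_ : NonZero v}} .{{_ : NonZero t}} {m n : ℕ} where

  𝒜⇒filling : {B : Cells m n} {Ω : Subset v} {A : PFArray v m n} → 𝒜 t h k B Ω A → Filling {B = B} Ω A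
  𝒜⇒filling {Ω = Ω} {A} record { quasiHeffter = qh ; skeleton = refl ; entries = entries } = record
    { skeleton  = refl
    ; injective = λ {c} {d} eq → entry-injective (trans (entry-at A c) (trans eq (sym (entry-at A d))))
    ; at∈Ω      = λ c → subst (_∈ Ω) (entry-at A c) (Equivalence.to (entries (entry A c)) (c , refl))
    ; onto      = λ {x} x∈ → let c , eq = Equivalence.from (entries x) x∈ in c , trans (sym (entry-at A c)) eq
    }
    where
    open IsQuasiHeffter qh
    entry-injective : ∀ {c d} → entry A c ≡ entry A d → c ≡ d
    entry-injective {c} {d} eq with proj₁ covers (entry A c) (proj₂ covers Sign.+ c)
    ... | _ , _ , unique = cong proj₂ (trans (sym (unique {Sign.+ , c} refl)) (unique {Sign.+ , d} (sym eq)))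

  -- The conditions on row and column sizes concern `B` alone, and the covering condition passes
  -- from `Ω` to the array along the bijection.
  filling⇒𝒜 : {B : Cells m n} {Ω : Subset v} {A : PFArray v m n} → v ≡ 2 * n * k + t → t ∣ 2 * n * k →
    (∀ i → ∣ lookup B i ∣ ≡ h) → (∀ j → ∣ column B j ∣ ≡ k) →
    ±CoversOnce t {I = ∃ λ (x : Fin v) → x ∈ Ω} proj₁ → Filling {B = B} Ω A → 𝒜 t h k B Ω A
  filling⇒𝒜 {Ω = Ω} {A} order t∣2nk rows columns covers
            F@record { skeleton = refl ; at∈Ω = at∈Ω ; onto = onto } = record
    { quasiHeffter = record
      { order = order ; divides = t∣2nk ; rows = rows ; columns = columns
      ; covers = (λ z z∉J → let w , eq = decode z z∉J in
          w , trans (signed-entry w) eq ,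
          λ {w′} eq′ → value-injective (trans eq (trans (sym eq′) (signed-entry w′))))
        , λ s c → value∉J (s , c) ∘ subst (InJ t) (signed-entry (s , c)) }
    ; skeleton = refl
    ; entries  = λ x → mk⇔ (λ (c , eq) → subst (_∈ Ω) (trans (sym (entry-at A c)) eq) (at∈Ω c))
                           (λ x∈ → let c , eq = onto x∈ in c , trans (entry-at A c) eq)
    }
    where
    open Labelling t covers F
    signed-entry : ∀ w → signed (proj₁ w) (entry A (proj₂ w)) ≡ value A w
    signed-entry (s , c) = cong (signed s) (entry-at A c)

module ArchdeaconSymmetries
  {v m n t h k : ℕ} .{{_ : NonZero v}} .{{_ : NonZero t}} (A : PFArray v m n)
  (qh : IsQuasiHeffter t h k A) (c₀ : Cell (skel A))
  (αr αc : Cell (skel A) ↔ Cell (skel A)) (compatible : Compatible αr αc)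
  where

  module 𝔸 = Archdeacon A qh c₀ αr αc compatible
  open Steps αr αc
  open Symmetries {v} t αr αc
  open Graph (K v t) using (OrientedEdge; source)

  target : OrientedEdge → Fin v
  target (_ , y , _) = y

  𝔸value : ∀ w → 𝔸.value w ≡ value A w
  𝔸value (s , c) = cong (signed s) (entry-at A c)

  𝔸step : ∀ w → 𝔸.step w ≡ step w
  𝔸step (Sign.+ , c) = refl
  𝔸step (Sign.- , c) = refl

  𝔸step⁻¹ : ∀ w → 𝔸.step⁻¹ w ≡ step⁻¹ w
  𝔸step⁻¹ (Sign.+ , c) = refl
  𝔸step⁻¹ (Sign.- , c) = refl

  ρBy : Sign → OrientedEdge → OrientedEdge
  ρBy Sign.+ = 𝔸.ρ
  ρBy Sign.- = 𝔸.ρ⁻¹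

  ρBy-edge : ∀ ε x w → target (ρBy ε (𝔸.edge x w)) ≡ x +ᵥ value A (stepBy ε w)
  ρBy-edge Sign.+ x w = trans (cong target (𝔸.ρ-edge x w))
    (cong (x +ᵥ_) (trans (𝔸value (𝔸.step w)) (cong (value A) (𝔸step w))))
  ρBy-edge Sign.- x w = trans (cong (target ∘ 𝔸.edge x ∘ 𝔸.step⁻¹) (𝔸.edgeCode-edge x w))
    (cong (x +ᵥ_) (trans (𝔸value (𝔸.step⁻¹ w)) (cong (value A) (𝔸step⁻¹ w))))

  target-edge : ∀ x w → target (𝔸.edge x w) ≡ x +ᵥ value A w
  target-edge x w = cong (x +ᵥ_) (𝔸value w)

  module _ (σ : Fin v ↔ Fin v) (aut : IsGraphAutomorphism {Γ = K v t} σ) where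

    act : OrientedEdge → OrientedEdge
    act = onEdges {Γ = K v t} σ aut

    -- An edge is determined by its endpoints and the rotation keeps the source, so commutation
    -- amounts to an identity between targets.
    commutes⇒rotates : ∀ ε → (∀ e → act (𝔸.ρ e) ≡ ρBy ε (act e)) → Rotates ε A (to σ)
    commutes⇒rotates ε comm x w w′ eq = begin
      to σ (x +ᵥ value A (step w))               ≡⟨ cong (to σ) (ρBy-edge Sign.+ x w) ⟨
      target (act (𝔸.ρ (𝔸.edge x w)))  ≡⟨ cong target (comm (𝔸.edge x w)) ⟩
      target (ρBy ε (act (𝔸.edge x w))) ≡⟨ cong (target ∘ ρBy ε) (𝔸.edge-≡ {to σ x}
          (trans (cong (to σ) (target-edge x w)) (trans eq (sym (target-edge (to σ x) w′))))) ⟩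
      target (ρBy ε (𝔸.edge (to σ x) w′))        ≡⟨ ρBy-edge ε (to σ x) w′ ⟩
      to σ x +ᵥ value A (stepBy ε w′)            ∎
      where open ≡-Reasoning

    source-ρBy : ∀ ε e → source (ρBy ε e) ≡ source e
    source-ρBy Sign.+ e = refl
    source-ρBy Sign.- e = refl

    edge-ext : ∀ {e e′ : OrientedEdge} → source e ≡ source e′ → target e ≡ target e′ → e ≡ e′
    edge-ext {_ , _ , _} {_ , _ , _} refl eq = 𝔸.edge-≡ eq

    rotates⇒commutes : ∀ ε → Rotates ε A (to σ) → ∀ e → act (𝔸.ρ e) ≡ ρBy ε (act e)
    rotates⇒commutes ε rot e = edge-ext (sym (source-ρBy ε e′)) (begin
      to σ (target (𝔸.ρ e))                ≡⟨ cong (to σ ∘ target ∘ 𝔸.ρ) (𝔸.edge-edgeCode e) ⟨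
      to σ (target (𝔸.ρ (𝔸.edge x w)))     ≡⟨ cong (to σ) (ρBy-edge Sign.+ x w) ⟩
      to σ (x +ᵥ value A (step w))         ≡⟨ rot x w w′ (begin
        to σ (x +ᵥ value A w)              ≡⟨ cong (to σ) (trans (sym (target-edge x w)) (cong target (𝔸.edge-edgeCode e))) ⟩
        target e′                          ≡⟨ cong target (𝔸.edge-edgeCode e′) ⟨
        target (𝔸.edge (to σ x) w′)        ≡⟨ target-edge (to σ x) w′ ⟩
        to σ x +ᵥ value A w′               ∎) ⟩
      to σ x +ᵥ value A (stepBy ε w′)      ≡⟨ ρBy-edge ε (to σ x) w′ ⟨
      target (ρBy ε (𝔸.edge (to σ x) w′))  ≡⟨ cong (target ∘ ρBy ε) (𝔸.edge-edgeCode e′) ⟩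
      target (ρBy ε e′)                    ∎)
      where
      open ≡-Reasoning
      x  = source e
      w  = 𝔸.edgeCode e
      e′ = act e
      w′ = 𝔸.edgeCode e′

  automorphism⇒symmetry : (∃ λ σ → IsAutomorphism 𝔸.Π σ × ¬ IsTranslation σ) → ∃₂ (IsSymmetry A)
  automorphism⇒symmetry (σ , (aut , comm) , ¬transl) = to σ , from σ , record
    { f-f⁻¹ = strictlyInverseˡ σ ; f⁻¹-f = strictlyInverseʳ σ ; adjacency = aut
    ; rotates = Sum.map (commutes⇒rotates σ aut Sign.+) (commutes⇒rotates σ aut Sign.-) comm
    ; nontranslation = ¬transl }

  symmetry⇒automorphism : ∃₂ (IsSymmetry A) → ∃ λ σ → IsAutomorphism 𝔸.Π σ × ¬ IsTranslation σ
  symmetry⇒automorphism (f , f⁻¹ , symmetry) = σ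
    , (adjacency , Sum.map (rotates⇒commutes σ adjacency Sign.+) (rotates⇒commutes σ adjacency Sign.-) rotates)
    , nontranslation
    where
    open IsSymmetry symmetry
    σ : Fin v ↔ Fin v
    σ = mk↔ₛ′ f f⁻¹ f-f⁻¹ f⁻¹-f

-- Identifying `B` with `skel A` is done once here; the counting needs a fixed `B` while `A` varies.
archdeacon-symmetries : {v m n t h k : ℕ} .{{_ : NonZero v}} .{{_ : NonZero m}} .{{_ : NonZero t}} .{{_ : NonZero h}}
  {B : Cells m n} {A : PFArray v m n} (qh : IsQuasiHeffter t h k A) (skel≡ : skel A ≡ B)
  (αr αc : Cell B ↔ Cell B) (compatible : Compatible αr αc) →
  (∃ λ σ → IsAutomorphism (archdeacon qh skel≡ αr αc compatible) σ × ¬ IsTranslation σ)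
  ⇔ ∃₂ (Symmetries.IsSymmetry {v} t αr αc A)
archdeacon-symmetries {v} {t = t} {A = A} qh refl αr αc compatible = mk⇔ automorphism⇒symmetry symmetry⇒automorphism
  where open ArchdeaconSymmetries A qh (someCell (skel A) (IsQuasiHeffter.rows qh)) αr αc compatible

module _ {v : ℕ} (t : ℕ) .{{_ : NonZero v}} .{{_ : NonZero t}} {m n : ℕ} {B : Cells m n} (αr αc : Cell B ↔ Cell B) where

  open Steps αr αc
  open Symmetries {v} t αr αc

  isSymmetry? : ∀ A f f⁻¹ → Dec (IsSymmetry A f f⁻¹)
  isSymmetry? A f f⁻¹ = map′
    (λ (p , q , a , r , nt) → record { f-f⁻¹ = p ; f⁻¹-f = q ; adjacency = a ; rotates = r ; nontranslation = nt })
    (λ S → let open IsSymmetry S in f-f⁻¹ , f⁻¹-f , adjacency , rotates , nontranslation)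
    (all? (λ x → f (f⁻¹ x) ≟ x)
      ×-dec all? (λ x → f⁻¹ (f x) ≟ x)
      ×-dec all? (λ x → all? λ y → adjK v t (f x) (f y) Bool.≟ adjK v t x y)
      ×-dec (rotates? Sign.+ ⊎-dec rotates? Sign.-)
      ×-dec ¬? (any? λ g → all? λ x → f x ≟ x +ᵥ g))
    where
    ∀ʷ : {P : Code {B = B} → Set} → Decidable P → Dec (∀ w → P w)
    ∀ʷ = ∀? allCodes ∈-allCodes
    rotates? : ∀ ε → Dec (Rotates ε A f)
    rotates? ε = all? λ x → ∀ʷ λ w → ∀ʷ λ w′ →
      (f (x +ᵥ value A w) ≟ f x +ᵥ value A w′) →-dec
      (f (x +ᵥ value A (step w)) ≟ f x +ᵥ value A (stepBy ε w′))

  -- The finite search runs over tables of values, which agree with a given function only pointwise.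
  isSymmetry-resp : ∀ {A f f⁻¹ g g⁻¹} → (∀ x → f x ≡ g x) → (∀ x → f⁻¹ x ≡ g⁻¹ x) →
                    IsSymmetry A f f⁻¹ → IsSymmetry A g g⁻¹
  isSymmetry-resp {A} {f} {f⁻¹} {g} {g⁻¹} f≗g f⁻¹≗g⁻¹ S = record
    { f-f⁻¹ = λ x → trans (sym (trans (cong f (f⁻¹≗g⁻¹ x)) (f≗g (g⁻¹ x)))) (f-f⁻¹ x)
    ; f⁻¹-f = λ x → trans (sym (trans (cong f⁻¹ (f≗g x)) (f⁻¹≗g⁻¹ (g x)))) (f⁻¹-f x)
    ; adjacency = λ x y → trans (cong₂ (adjK v t) (sym (f≗g x)) (sym (f≗g y))) (adjacency x y)
    ; rotates = Sum.map (rotates-resp Sign.+) (rotates-resp Sign.-) rotates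
    ; nontranslation = λ (a , eq) → nontranslation (a , λ x → trans (f≗g x) (eq x))
    }
    where
    open IsSymmetry S
    rotates-resp : ∀ ε → Rotates ε A f → Rotates ε A g
    rotates-resp ε rot x w w′ eq = trans (sym (f≗g _)) (trans
      (rot x w w′ (trans (f≗g _) (trans eq (cong (_+ᵥ value A w′) (sym (f≗g x))))))
      (cong (_+ᵥ value A (stepBy ε w′)) (f≗g x)))

  hasSymmetry? : ∀ A → Dec (∃₂ (IsSymmetry A))
  hasSymmetry? A = map′
    (λ (fs , gs , S) → lookup fs , lookup gs , S)
    (λ (f , f⁻¹ , S) → Vec.tabulate f , Vec.tabulate f⁻¹ ,
      isSymmetry-resp (λ x → sym (Vec.lookup∘tabulate f x)) (λ x → sym (Vec.lookup∘tabulate f⁻¹ x)) S)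
    (∃ᶠ λ fs → ∃ᶠ λ gs → isSymmetry? A (lookup fs) (lookup gs))
    where
    ∃ᶠ : {P : Vec (Fin v) v → Set} → Decidable P → Dec (∃ P)
    ∃ᶠ = ∃? (allVecs (allFin v) v) (∈-allVecs ∈-allFin)

-- The probability and its bound

/-mono-≤ : ∀ {a b c d} .{{_ : NonZero b}} .{{_ : NonZero d}} → a * d ≤ c * b → + a / b ≤ℚ + c / d
/-mono-≤ {a} {b@(suc b′)} {c} {d@(suc d′)} ad≤cb = ℚ.toℚᵘ-cancel-≤
  (ℚᵘ.≤-respˡ-≃ (ℚᵘ.≃-sym (ℚ.toℚᵘ-fromℚᵘ (ℚᵘ.mkℚᵘ (+ a) b′)))
  (ℚᵘ.≤-respʳ-≃ (ℚᵘ.≃-sym (ℚ.toℚᵘ-fromℚᵘ (ℚᵘ.mkℚᵘ (+ c) d′)))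
    (ℚᵘ.*≤* (subst₂ ℤ._≤_ (ℤ.pos-* a d) (ℤ.pos-* c b) (ℤ.+≤+ ad≤cb)))))

-- This is `2 * (2 * triangleBound D T)` with the factor `T` removed.
leading : ℕ → ℕ
leading D = 4 * (4 * (D * D) + 32 * D + 192)

-- The summand 33 covers arrays with at most 32 cells, the other one all larger arrays; `t + 32` is
-- the number of exceptional thirds when `js` lists `J`.
constant : ℕ → ℕ
constant t = 33 + leading (t + 32)

module RandomFilling
  {v t m n h k : ℕ} .{{_ : NonZero v}} .{{_ : NonZero t}} .{{_ : NonZero m}} .{{_ : NonZero h}}
  (order : v ≡ 2 * n * k + t) (t∣2nk : t ∣ 2 * n * k) (3≤h : 3 ≤ h) (3≤k : 3 ≤ k)
  (B : Cells m n) (rows : ∀ i → ∣ lookup B i ∣ ≡ h) (columns : ∀ j → ∣ column B j ∣ ≡ k)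
  (αr αc : Cell B ↔ Cell B) (row-ordering : IsRowOrdering αr) (column-ordering : IsColumnOrdering αc)
  (compatible : Compatible αr αc)
  (Ω : Subset v) (covers : ±CoversOnce t {I = ∃ λ (x : Fin v) → x ∈ Ω} proj₁) where

  open Symmetries {v} t αr αc using (IsSymmetry; symmetric-triangles)
  open SubgroupJ {v} t (subst (t ∣_) (sym order) (∣m∣n⇒∣m+n t∣2nk ∣-refl))

  Symmetrical : PFArray v m n → Set
  Symmetrical A = Filling {B = B} Ω A × ∃₂ (IsSymmetry A)

  abstract
    fillings : Enumeration (Filling {B = B} Ω)
    fillings = enumerate _≟ᴬ_ ∈-allArrays filling?

    symmetrical : Enumeration Symmetrical
    symmetrical = enumerate _≟ᴬ_ ∈-allArrays (λ A → filling? A ×-dec hasSymmetry? {v} t αr αc A)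

  open Enumeration using (size)

  N≡nk : length (allCells {B = B}) ≡ n * k
  N≡nk = length-allCells columns

  ∣Ω∣≡nk : ∣ Ω ∣ ≡ n * k
  ∣Ω∣≡nk = *-cancelˡ-≡ ∣ Ω ∣ (n * k) 2 (+-cancelʳ-≡ t (2 * ∣ Ω ∣) (2 * (n * k))
    (trans (2∣Ω∣+t≡v covers) (trans order (cong (_+ t) (*-assoc 2 n k)))))

  size-fillings : NonZero (size fillings)
  size-fillings = ℕ.>-nonZero (∈-length (Enumeration.complete fillings
    (proj₂ (some-filling {B = B} {Ω} (trans N≡nk (sym ∣Ω∣≡nk))))))

  symmetrical-≤-fillings : size symmetrical ≤ size fillings
  symmetrical-≤-fillings = unique-⊆⇒length-≤ (Enumeration.unique symmetrical)
    (Enumeration.complete fillings ∘ proj₁ ∘ Enumeration.sound symmetrical)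

  module _ (33≤N : 33 ≤ length (allCells {B = B})) where

    private
      3≤rows : ∀ i → 3 ≤ ∣ lookup B i ∣
      3≤rows i = subst (3 ≤_) (sym (rows i)) 3≤h
      3≤columns : ∀ j → 3 ≤ ∣ column B j ∣
      3≤columns j = subst (3 ≤_) (sym (columns j)) 3≤k
      w₀ : Code {B = B}
      w₀ = Sign.+ , someCell B rows

    open Asymmetry B Ω fillings 33≤N αr αc compatible row-ordering column-ordering 3≤rows 3≤columns allJ w₀

    large-bound : n * k * size symmetrical ≤ constant t * size fillings
    large-bound = begin
      n * k * size symmetrical                        ≡⟨ cong (_* size symmetrical) N≡nk ⟨
      length (allCells {B = B}) * size symmetrical    ≤⟨ symmetric-sparse .bound (Enumeration.unique symmetrical)
                                                          (All.tabulate (triangles ∘ Enumeration.sound symmetrical)) ⟩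
      2 * (2 * limit)                                 ≡⟨ polynomial (length allJ + 32) (size fillings) ⟩
      leading (length allJ + 32) * size fillings      ≡⟨ cong (λ l → leading (l + 32) * size fillings) length-allJ ⟩
      leading (t + 32) * size fillings                ≤⟨ *-monoˡ-≤ (size fillings) (m≤n+m (leading (t + 32)) 33) ⟩
      constant t * size fillings                      ∎
      where
      open ≤-Reasoning
      triangles : ∀ {A} → Symmetrical A → _
      triangles (F , _ , _ , S) = F , symmetric-triangles compatible row-ordering column-ordering
        3≤rows 3≤columns covers F w₀ allJ-complete S
      polynomial : ∀ D T → 2 * (2 * (D * (D * (4 * T)) + (2 * (D * (8 * T)) + (2 * (D * (8 * T)) + (2 * (8 * (8 * T)) + 2 * (2 * (16 * T)))))))
                         ≡ 4 * (4 * (D * D) + 32 * D + 192) * T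
      polynomial = solve-∀

  bound-symmetrical : n * k * size symmetrical ≤ constant t * size fillings
  bound-symmetrical with 33 ≤? length (allCells {B = B})
  ... | yes 33≤N = large-bound 33≤N
  -- Here `n * k` is below 33 and the probability is at most 1.
  ... | no  33≰N = *-mono-≤ (≤-trans (subst (_≤ 33) N≡nk (≤-trans (n≤1+n _) (≰⇒> 33≰N))) (m≤m+n 33 (leading (t + 32)))) symmetrical-≤-fillings

  open UniformProbability using (outcomes; event; nonempty)

  F⇒𝒜 : ∀ {A} → Filling {B = B} Ω A → 𝒜 t h k B Ω A
  F⇒𝒜 = filling⇒𝒜 {v} t h k order t∣2nk rows columns covers

  symmetries : ∀ {A} (A∈ : 𝒜 t h k B Ω A) → HasNonTranslation αr αc compatible A∈ ⇔ ∃₂ (IsSymmetry A)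
  symmetries {A} A∈ = archdeacon-symmetries {v} {m} {n} {t} {h} {k} {B} {A} (𝒜.quasiHeffter A∈) (𝒜.skeleton A∈) αr αc compatible

  Event : PFArray v m n → Set
  Event A = Σ (𝒜 t h k B Ω A) (HasNonTranslation αr αc compatible)

  symmetrical⇒event : ∀ {A} → Symmetrical A → Event A
  symmetrical⇒event (F , S) = F⇒𝒜 F , Equivalence.from (symmetries (F⇒𝒜 F)) S

  event⇒symmetrical : ∀ {A} → Event A → Symmetrical A
  event⇒symmetrical (A∈ , E) = 𝒜⇒filling {v} t h k A∈ , Equivalence.to (symmetries A∈) E

  probability : UniformProbability (𝒜 t h k B Ω) (HasNonTranslation αr αc compatible)
  probability .outcomes = enumeration-map F⇒𝒜 (𝒜⇒filling {v} t h k) fillings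
  probability .event    = enumeration-map symmetrical⇒event event⇒symmetrical symmetrical
  probability .nonempty = size-fillings

  probability-≤ : .{{_ : NonZero n}} .{{_ : NonZero k}} →
                  UniformProbability.value probability ≤ℚ (+ constant t / (n * k)) {{m*n≢0 n k}}
  probability-≤ = /-mono-≤ {size symmetrical} {size fillings} {constant t} {n * k} {{size-fillings}} {{m*n≢0 n k}}
    (≤-trans (≤-reflexive (*-comm (size symmetrical) (n * k))) bound-symmetrical)

theorem3p12 : (t : ℕ) .{{_ : NonZero t}} → ∃ λ (C : ℕ) →
    (m n h k v : ℕ) .{{_ : NonZero m}} .{{_ : NonZero n}} .{{_ : NonZero h}} .{{_ : NonZero k}} .{{_ : NonZero v}} →
    v ≡ 2 * n * k + t → t ∣ 2 * n * k → 3 ≤ h → 3 ≤ k →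
    (B : Cells m n) → (∀ i → ∣ lookup B i ∣ ≡ h) → (∀ j → ∣ column B j ∣ ≡ k) →
    (αr αc : Cell B ↔ Cell B) → IsRowOrdering αr → IsColumnOrdering αc →
    (compatible : Compatible αr αc) →
    (Ω : Subset v) → ±CoversOnce t {I = ∃ λ (x : Fin v) → x ∈ Ω} proj₁ →
    Σ (UniformProbability (𝒜 t h k B Ω) (HasNonTranslation αr αc compatible)) λ ℙ →
    UniformProbability.value ℙ ≤ℚ (+ C / (n * k)) {{m*n≢0 n k}}
theorem3p12 t = constant t , λ m n h k v order t∣2nk 3≤h 3≤k B rows columns αr αc row-ordering column-ordering compatible Ω covers →
  let open RandomFilling order t∣2nk 3≤h 3≤k B rows columns αr αc row-ordering column-ordering compatible Ω covers
  in probability , probability-≤
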